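{- Assume $K$ is a perfect $A$-field. Let $\Phi$ and $\Psi$ be $\mathbf t$-modules over $K$. Then there is an isomorphism of $\mathbb F_q[t]$-modules $$\operatorname{Ext}^1_\tau(\Phi,\Psi)\cong\operatorname{Ext}^1_\sigma(\Psi^\sigma,\Phi^\sigma).$$
   Context: $A=\mathbb F_q[t]$; $K$ a perfect field of characteristic $p$ with $\mathbb F_q$-algebra map $\iota:A\to K$, $\theta=\iota(t)$. $K\{\tau\}$: twisted polynomials with $\tau x=x^q\tau$; $K\{\sigma\}$: twisted polynomials with $\sigma x=x^{(-1)}\sigma$, where $c^{(-k)}=c^{q^{ -k}}$ and $c^{(k)}=c^{q^k}$. A $\mathbf t$-module of dimension $d$ is an $\mathbb F_q$-algebra homomorphism $\Phi:\mathbb F_q[t]\to\mathrm{Mat}_d(K\{\tau\})$ with $\Phi_t=(\theta I+N)+\sum_{i\ge1}M_i\tau^i$, $N$ nilpotent; a $\mathbf t^\sigma$-module is defined identically with $\sigma$ in place of $\tau$. Define $(-)^\sigma:K\{\tau\}\to K\{\sigma\}$ by $(\sum a_i\tau^i)^\sigma=\sum a_i^{(-i)}\sigma^i$, and for a $\mathbf t$-module $\Phi$ of dimension $d$ let $\Phi^\sigma:\mathbb F_q[t]\to\mathrm{Mat}_d(K\{\sigma\})$ be given by $\Phi^\sigma_a=$ the transpose of the matrix obtained by applying $(-)^\sigma$ entrywise to $\Phi_a$ (a $\mathbf t^\sigma$-module). For $\mathbf t$-modules (resp. $\mathbf t^\sigma$-modules) $\Phi$ of dim $d$, $\Psi$ of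 dim $e$: $\mathrm{Der}(\Phi,\Psi)$ is the space of $\mathbb F_q$-linear $\delta:\mathbb F_q[t]\to\mathrm{Mat}_{e\times d}(K\{\tau\})$ (resp. $K\{\sigma\}$) with $\delta(ab)=\Psi_a\delta(b)+\delta(a)\Phi_b$; inner biderivations are $\delta^{(U)}(a)=U\Phi_a-\Psi_aU$; $\operatorname{Ext}^1_\tau(\Phi,\Psi)$ (resp. $\operatorname{Ext}^1_\sigma(\Phi,\Psi)$) is $\mathrm{Der}(\Phi,\Psi)/\mathrm{Der}_{in}(\Phi,\Psi)$ with $\mathbb F_q[t]$-module structure $a*[\delta]=[\Psi_a\delta]$ (equivalently $[\delta\Phi_a]$); it is the group of extensions of $\Phi$ by $\Psi$ in the respective category. -}

module Defs where

open import Level using (Level; _⊔_) renaming (suc to lsuc)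
open import Algebra.Apartness.Bundles using (HeytingField; HeytingCommutativeRing)
open import Algebra.Bundles using (Ring; CommutativeRing; AbelianGroup)
open import Algebra.Definitions using (Invertible)
open import Algebra.Module.Bundles using (Module)
open import Algebra.Module.Morphism.Structures using (IsModuleIsomorphism)
open import Algebra.Module.Structures using (IsLeftModule)
open import Algebra.Module.Structures.Biased using (IsModuleFromLeft)
open import Algebra.Morphism.Structures using (IsRingHomomorphism)
open import Data.Fin.Base using (Fin; zero; suc; toℕ; inject₁; fromℕ)
open import Data.Fin.Permutation using (Permutation′; permutation; reverse; _⟨$⟩ʳ_)
open import Data.Fin.Properties using (_≟_; any?; toℕ<n; opposite-prop; toℕ-inject₁; toℕ-fromℕ; toℕ≤pred[n])
open import Data.Nat.Base as ℕ using (ℕ; zero; suc; _∸_; _≤_; _<_; s≤s; _!)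
open import Data.Nat.Combinatorics using (_C_; nCk≡n!/k![n-k]!; k![n∸k]!∣n!; nCn≡1)
open import Data.Nat.Divisibility using (_∣_; divides-refl; ∣⇒≤; ∣m⇒∣m*n; ∣-refl)
open import Data.Nat.DivMod using (m/n*n≡m)
open import Data.Nat.GeneralisedArithmetic using (iterate)
open import Data.Nat.Primality using (Prime; euclidsLemma; prime⇒nonZero; prime⇒nonTrivial)
open import Data.Product.Base using (∃; _,_; proj₁; proj₂)
open import Data.Sum.Base using (inj₁; inj₂)
open import Function.Base using (_∘_; id)
open import Function.Bundles using (Inverse)
open import Function.Definitions using (Surjective)
open import Relation.Binary.PropositionalEquality as ≡ using (_≡_)
open import Relation.Nullary.Decidable using (Dec; yes; no)
open import Relation.Nullary.Negation using (¬_; contradiction)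

import Algebra.Construct.Pointwise as Pointwise
import Algebra.Properties.AbelianGroup as AbelianGroupProperties
import Algebra.Properties.CommutativeMonoid.Sum as CommutativeMonoidSum
import Algebra.Properties.CommutativeSemigroup as CommutativeSemigroupProperties
import Algebra.Properties.CommutativeSemiring.Binomial as Binomial
import Algebra.Properties.CommutativeSemiring.Exp as CommutativeExp
import Algebra.Properties.Ring as RingProperties
import Algebra.Properties.Semiring.Exp as Exp
import Algebra.Properties.Semiring.Mult as Mult
import Algebra.Properties.Semiring.Sum as Sum
import Data.Nat.Properties as ℕₚ
import Relation.Binary.Reasoning.Setoid as SetoidReasoning

private
  variable
    c c₁ c₂ ℓ ℓ₁ ℓ₂ : Level

module _ (R : Ring c₁ ℓ₁) (S : Ring c₂ ℓ₂) where
  private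
    module R = Ring R
    module S = Ring S

  IsRingHom : (R.Carrier → S.Carrier) → Set (c₁ ⊔ ℓ₁ ⊔ ℓ₂)
  IsRingHom = IsRingHomomorphism R.rawRing S.rawRing

  mkIsRingHom : (f : R.Carrier → S.Carrier) →
                (∀ {x y} → x R.≈ y → f x S.≈ f y) →
                (∀ x y → f (x R.+ y) S.≈ f x S.+ f y) →
                (∀ x y → f (x R.* y) S.≈ f x S.* f y) →
                f R.1# S.≈ S.1# →
                IsRingHom f
  mkIsRingHom f cong +-homo *-homo 1-homo = record
    { isSemiringHomomorphism = record
      { isNearSemiringHomomorphism = record
        { +-isMonoidHomomorphism = record
          { isMagmaHomomorphism = record
            { isRelHomomorphism = record { cong = cong }
            ; homo = +-homo
            }
          ; ε-homo = 0-homo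
          }
        ; *-homo = *-homo
        }
      ; 1#-homo = 1-homo
      }
    ; -‿homo = λ x → inverseˡ-unique (f (R.- x)) (f x)
        (S.trans (S.sym (+-homo _ _)) (S.trans (cong (R.-‿inverseˡ x)) 0-homo))
    }
    where
    open AbelianGroupProperties S.+-abelianGroup using (inverseˡ-unique)
    0-homo : f R.0# S.≈ S.0#
    0-homo = RingProperties.x+x≈x⇒x≈0 S (f R.0#)
      (S.trans (S.sym (+-homo _ _)) (cong (R.+-identityˡ _)))

record Endomorphism (R : Ring c ℓ) : Set (c ⊔ ℓ) where
  private module R = Ring R
  field
    apply     : R.Carrier → R.Carrier
    isRingHom : IsRingHom R R apply

  open IsRingHomomorphism isRingHom public

  apply^ : ℕ → R.Carrier → R.Carrier
  apply^ n x = iterate apply x n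

  apply^-cong : ∀ n {x y} → x R.≈ y → apply^ n x R.≈ apply^ n y
  apply^-cong zero    eq = eq
  apply^-cong (suc n) eq = apply^-cong n (⟦⟧-cong eq)

  apply^-isRingHom : ∀ n → IsRingHom R R (apply^ n)
  apply^-isRingHom n = mkIsRingHom R R (apply^ n) (apply^-cong n) (+-homo^ n) (*-homo^ n) (1-homo^ n)
    where
    +-homo^ : ∀ n x y → apply^ n (x R.+ y) R.≈ apply^ n x R.+ apply^ n y
    +-homo^ zero    x y = R.refl
    +-homo^ (suc n) x y = R.trans (apply^-cong n (+-homo x y)) (+-homo^ n _ _)
    *-homo^ : ∀ n x y → apply^ n (x R.* y) R.≈ apply^ n x R.* apply^ n y
    *-homo^ zero    x y = R.refl
    *-homo^ (suc n) x y = R.trans (apply^-cong n (*-homo x y)) (*-homo^ n _ _)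
    1-homo^ : ∀ n → apply^ n R.1# R.≈ R.1#
    1-homo^ zero    = R.refl
    1-homo^ (suc n) = R.trans (apply^-cong n 1#-homo) (1-homo^ n)

  apply^-suc : ∀ n x → apply^ n (apply x) ≡ apply (apply^ n x)
  apply^-suc zero    x = ≡.refl
  apply^-suc (suc n) x = apply^-suc n (apply x)

  apply^-+ : ∀ m n x → apply^ (m ℕ.+ n) x ≡ apply^ n (apply^ m x)
  apply^-+ zero    n x = ≡.refl
  apply^-+ (suc m) n x = apply^-+ m n (apply x)

idEndomorphism : (R : Ring c ℓ) → Endomorphism R
idEndomorphism R = record
  { apply     = id
  ; isRingHom = mkIsRingHom R R id id (λ _ _ → refl) (λ _ _ → refl) refl
  }
  where open Ring R using (refl)

module _ (R : Ring c ℓ) where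
  open Ring R
  open Sum semiring

  sum-homo : ∀ {S : Ring c₂ ℓ₂} {f : Ring.Carrier S → Carrier} → IsRingHom S R f →
             ∀ {n} (t : Fin n → Ring.Carrier S) →
             f (Sum.sum (Ring.semiring S) t) ≈ sum (f ∘ t)
  sum-homo {S = S} hom {zero}  t = IsRingHomomorphism.0#-homo hom
  sum-homo {S = S} hom {suc n} t =
    trans (IsRingHomomorphism.+-homo hom _ _) (+-congˡ (sum-homo {S = S} hom (t ∘ suc)))

-- The skew polynomial ring R{X} with X x = φ(x) X; coefficients are written on the left, so that
-- (f g)ₙ = Σ_{i+j=n} fᵢ φⁱ(gⱼ).

module SkewPolynomial (R : Ring c ℓ) (φ : Endomorphism R) where
  open Ring R
  open Sum semiring
  open SetoidReasoning setoid
  private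
    module φ = Endomorphism φ
    open φ using (apply; apply^)

  -- Σᵢ coeff i Xⁱ, the coefficients vanishing from index `bound` on; `bound` is not
  -- required to be optimal and is ignored by the equality.
  record Poly : Set (c ⊔ ℓ) where
    field
      coeff    : ℕ → Carrier
      bound    : ℕ
      vanishes : ∀ n → bound ≤ n → coeff n ≈ 0#
  open Poly public

  infix 4 _≈ₚ_
  record _≈ₚ_ (f g : Poly) : Set ℓ where
    constructor mk≈ₚ
    field
      coeff-≈ : ∀ n → coeff f n ≈ coeff g n
  open _≈ₚ_ public

  convolution : (ℕ → Carrier) → (ℕ → Carrier) → ℕ → Carrier
  convolution f g n = ∑[ i ≤ n ] (f (toℕ i) * apply^ (toℕ i) (g (n ∸ toℕ i)))

  constantCoeff : Carrier → ℕ → Carrier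
  constantCoeff x zero    = x
  constantCoeff x (suc _) = 0#

  private
    Seq = ℕ → Carrier

    sum-zero : ∀ {n} (t : Fin n → Carrier) → (∀ i → t i ≈ 0#) → sum t ≈ 0#
    sum-zero {n} t eq = trans (sum-cong-≋ eq) (sum-replicate-zero n)

    term : Seq → Seq → ∀ n → Fin (suc n) → Carrier
    term f g n i = f (toℕ i) * apply^ (toℕ i) (g (n ∸ toℕ i))

    conv-cong : ∀ {f f′ g g′ : Seq} → (∀ n → f n ≈ f′ n) → (∀ n → g n ≈ g′ n) →
                ∀ n → convolution f g n ≈ convolution f′ g′ n
    conv-cong {f} {f′} {g} {g′} p q n = sum-cong-≋ {suc n} {term f g n} {term f′ g′ n}
      λ i → *-cong (p (toℕ i)) (φ.apply^-cong (toℕ i) (q (n ∸ toℕ i)))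

    conv-distribʳ : ∀ (h f g : Seq) n →
      convolution (λ k → f k + g k) h n ≈ convolution f h n + convolution g h n
    conv-distribʳ h f g n = trans
      (sum-cong-≋ {suc n} {term (λ k → f k + g k) h n} {λ i → term f h n i + term g h n i}
        λ i → distribʳ (apply^ (toℕ i) (h (n ∸ toℕ i))) (f (toℕ i)) (g (toℕ i)))
      (∑-distrib-+ (term f h n) (term g h n))

    conv-distribˡ : ∀ (h f g : Seq) n →
      convolution h (λ k → f k + g k) n ≈ convolution h f n + convolution h g n
    conv-distribˡ h f g n = trans
      (sum-cong-≋ {suc n} {term h (λ k → f k + g k) n} {λ i → term h f n i + term h g n i}
        λ i → trans
          (*-congˡ (IsRingHomomorphism.+-homo (φ.apply^-isRingHom (toℕ i)) (f (n ∸ toℕ i)) (g (n ∸ toℕ i))))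
          (distribˡ (h (toℕ i)) _ _))
      (∑-distrib-+ (term h f n) (term h g n))

    conv-scale : ∀ x (f g : Seq) n → convolution (λ k → x * f k) g n ≈ x * convolution f g n
    conv-scale x f g n = trans
      (sum-cong-≋ {suc n} {term (λ k → x * f k) g n} {λ i → x * term f g n i}
        λ i → *-assoc x (f (toℕ i)) (apply^ (toℕ i) (g (n ∸ toℕ i))))
      (sym (*-distribˡ-sum x (term f g n)))

    conv-zeroˡ : ∀ (g : Seq) n → convolution (λ _ → 0#) g n ≈ 0#
    conv-zeroˡ g n = sum-zero (term (λ _ → 0#) g n) λ i → zeroˡ _

    conv-apply : ∀ (f g : Seq) n →
      apply (convolution f g n) ≈ convolution (apply ∘ f) (apply ∘ g) n
    conv-apply f g zero = trans (φ.+-homo _ _) (+-cong (φ.*-homo _ _) φ.0#-homo)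
    conv-apply f g (suc n) =
      trans (φ.+-homo _ _) (+-cong (φ.*-homo _ _) (conv-apply (f ∘ suc) (apply ∘ g) n))

    conv-assoc : ∀ (f g h : Seq) n →
      convolution (convolution f g) h n ≈ convolution f (convolution g h) n
    conv-assoc f g h zero = +-congʳ (begin
      (f 0 * g 0 + 0#) * h 0  ≈⟨ *-congʳ (+-identityʳ _) ⟩
      f 0 * g 0 * h 0         ≈⟨ *-assoc _ _ _ ⟩
      f 0 * (g 0 * h 0)       ≈⟨ *-congˡ (+-identityʳ _) ⟨
      f 0 * (g 0 * h 0 + 0#)  ∎)
    conv-assoc f g h (suc n) = begin
      (f 0 * g 0 + 0#) * h (suc n) + convolution (λ k → f 0 * g′ k + convolution f′ φg k) φh n
        ≈⟨ +-cong (trans (*-congʳ (+-identityʳ _)) (*-assoc _ _ _)) (conv-distribʳ φh (λ k → f 0 * g′ k) (convolution f′ φg) n) ⟩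
      f 0 * (g 0 * h (suc n)) + (convolution (λ k → f 0 * g′ k) φh n + convolution (convolution f′ φg) φh n)
        ≈⟨ +-assoc _ _ _ ⟨
      f 0 * (g 0 * h (suc n)) + convolution (λ k → f 0 * g′ k) φh n + convolution (convolution f′ φg) φh n
        ≈⟨ +-cong
             (trans (+-congˡ (conv-scale (f 0) g′ φh n)) (sym (distribˡ _ _ _)))
             (trans (conv-assoc f′ φg φh n)
                    (conv-cong {f′} (λ _ → refl) (λ k → sym (conv-apply g h k)) n)) ⟩
      f 0 * (g 0 * h (suc n) + convolution g′ φh n) + convolution f′ (apply ∘ convolution g h) n
        ∎
      where
      f′ = f ∘ suc
      g′ = g ∘ suc
      φg = apply ∘ g
      φh = apply ∘ h

    conv-constantˡ : ∀ x (g : Seq) n → convolution (constantCoeff x) g n ≈ x * g n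
    conv-constantˡ x g zero    = +-identityʳ _
    conv-constantˡ x g (suc n) = trans (+-congˡ (conv-zeroˡ (apply ∘ g) n)) (+-identityʳ _)

    conv-constantʳ : ∀ (f : Seq) x n → convolution f (constantCoeff x) n ≈ f n * apply^ n x
    conv-constantʳ f x zero    = +-identityʳ _
    conv-constantʳ f x (suc n) = begin
      f 0 * 0# + convolution f′ (apply ∘ constantCoeff x) n  ≈⟨ +-congʳ (zeroʳ _) ⟩
      0# + convolution f′ (apply ∘ constantCoeff x) n        ≈⟨ +-identityˡ _ ⟩
      convolution f′ (apply ∘ constantCoeff x) n             ≈⟨ conv-cong {f′} (λ _ → refl) apply-constant n ⟩
      convolution f′ (constantCoeff (apply x)) n             ≈⟨ conv-constantʳ f′ (apply x) n ⟩
      f (suc n) * apply^ n (apply x)                         ∎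
      where
      f′ = f ∘ suc
      apply-constant : ∀ k → apply (constantCoeff x k) ≈ constantCoeff (apply x) k
      apply-constant zero    = refl
      apply-constant (suc k) = φ.0#-homo

    conv-vanishes : ∀ (f g : Poly) n → bound f ℕ.+ bound g ≤ n →
                    convolution (coeff f) (coeff g) n ≈ 0#
    conv-vanishes f g n M+N≤n = sum-zero (term (coeff f) (coeff g) n) λ i → term≈0 (toℕ i)
      where
      term≈0 : ∀ i → coeff f i * apply^ i (coeff g (n ∸ i)) ≈ 0#
      term≈0 i with ℕₚ.≤-total (bound f) i
      ... | inj₁ M≤i = trans (*-congʳ (vanishes f i M≤i)) (zeroˡ _)
      ... | inj₂ i≤M = begin
        coeff f i * apply^ i (coeff g (n ∸ i))
          ≈⟨ *-congˡ (φ.apply^-cong i (vanishes g (n ∸ i) N≤n∸i)) ⟩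
        coeff f i * apply^ i 0#
          ≈⟨ *-congˡ (IsRingHomomorphism.0#-homo (φ.apply^-isRingHom i)) ⟩
        coeff f i * 0#
          ≈⟨ zeroʳ _ ⟩
        0# ∎
        where
        N≤n∸i : bound g ≤ n ∸ i
        N≤n∸i = ℕₚ.m+n≤o⇒m≤o∸n (bound g) (ℕₚ.≤-trans
          (ℕₚ.≤-trans (ℕₚ.+-monoʳ-≤ (bound g) i≤M) (ℕₚ.≤-reflexive (ℕₚ.+-comm (bound g) (bound f))))
          M+N≤n)

  constant : Carrier → Poly
  constant x = record
    { coeff    = constantCoeff x
    ; bound    = 1
    ; vanishes = λ { (suc n) _ → refl }
    }

  variable-X : Poly
  variable-X = record
    { coeff    = λ { 1 → 1# ; _ → 0# }
    ; bound    = 2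
    ; vanishes = λ { 1 (s≤s ()) ; (suc (suc n)) _ → refl }
    }

  infixl 6 _+ₚ_
  infixl 7 _*ₚ_
  infix  8 -ₚ_

  _+ₚ_ : Poly → Poly → Poly
  f +ₚ g = record
    { coeff    = λ n → coeff f n + coeff g n
    ; bound    = bound f ℕ.⊔ bound g
    ; vanishes = λ n le → trans
        (+-cong (vanishes f n (ℕₚ.m⊔n≤o⇒m≤o _ _ le)) (vanishes g n (ℕₚ.m⊔n≤o⇒n≤o _ _ le)))
        (+-identityˡ 0#)
    }

  -ₚ_ : Poly → Poly
  -ₚ f = record
    { coeff    = λ n → - coeff f n
    ; bound    = bound f
    ; vanishes = λ n le → trans (-‿cong (vanishes f n le)) -0≈0
    }
    where open AbelianGroupProperties +-abelianGroup using () renaming (ε⁻¹≈ε to -0≈0)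

  _*ₚ_ : Poly → Poly → Poly
  f *ₚ g = record
    { coeff    = convolution (coeff f) (coeff g)
    ; bound    = bound f ℕ.+ bound g
    ; vanishes = conv-vanishes f g
    }

  ring : Ring (c ⊔ ℓ) ℓ
  ring = record
    { Carrier = Poly
    ; _≈_     = _≈ₚ_
    ; _+_     = _+ₚ_
    ; _*_     = _*ₚ_
    ; -_      = -ₚ_
    ; 0#      = constant 0#
    ; 1#      = constant 1#
    ; isRing  = record
      { +-isAbelianGroup = record
        { isGroup = record
          { isMonoid = record
            { isSemigroup = record
              { isMagma = record
                { isEquivalence = record
                  { refl  = mk≈ₚ λ _ → refl
                  ; sym   = λ p → mk≈ₚ λ n → sym (coeff-≈ p n)
                  ; trans = λ p q → mk≈ₚ λ n → trans (coeff-≈ p n) (coeff-≈ q n)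
                  }
                ; ∙-cong = λ p q → mk≈ₚ λ n → +-cong (coeff-≈ p n) (coeff-≈ q n)
                }
              ; assoc = λ f g h → mk≈ₚ λ n → +-assoc _ _ _
              }
            ; identity = (λ f → mk≈ₚ λ n → trans (+-congʳ (coeff-0 n)) (+-identityˡ _))
                       , (λ f → mk≈ₚ λ n → trans (+-congˡ (coeff-0 n)) (+-identityʳ _))
            }
          ; inverse = (λ f → mk≈ₚ λ n → trans (-‿inverseˡ _) (sym (coeff-0 n)))
                    , (λ f → mk≈ₚ λ n → trans (-‿inverseʳ _) (sym (coeff-0 n)))
          ; ⁻¹-cong = λ p → mk≈ₚ λ n → -‿cong (coeff-≈ p n)
          }
        ; comm = λ f g → mk≈ₚ λ n → +-comm _ _
        }
      ; *-cong     = λ p q → mk≈ₚ (conv-cong (coeff-≈ p) (coeff-≈ q))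
      ; *-assoc    = λ f g h → mk≈ₚ (conv-assoc (coeff f) (coeff g) (coeff h))
      ; *-identity = (λ f → mk≈ₚ λ n → trans (conv-constantˡ 1# (coeff f) n) (*-identityˡ _))
                   , (λ f → mk≈ₚ λ n → trans (conv-constantʳ (coeff f) 1# n)
                       (trans (*-congˡ (IsRingHomomorphism.1#-homo (φ.apply^-isRingHom n))) (*-identityʳ _)))
      ; distrib    = (λ f g h → mk≈ₚ (conv-distribˡ (coeff f) (coeff g) (coeff h)))
                   , (λ f g h → mk≈ₚ (conv-distribʳ (coeff f) (coeff g) (coeff h)))
      }
    }
    where
    coeff-0 : ∀ n → constantCoeff 0# n ≈ 0#
    coeff-0 zero    = refl
    coeff-0 (suc n) = refl

  constant-*ˡ : ∀ x f n → coeff (constant x *ₚ f) n ≈ x * coeff f n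
  constant-*ˡ x f = conv-constantˡ x (coeff f)

  constant-*ʳ : ∀ f x n → coeff (f *ₚ constant x) n ≈ coeff f n * apply^ n x
  constant-*ʳ f x = conv-constantʳ (coeff f) x

-- (-)* : R{X; φ} → R{Y; ψ}, Σ aᵢ Xⁱ ↦ Σ ψⁱ(aᵢ) Yⁱ, is an anti-homomorphism when ψ φ = id.

module Star (R : CommutativeRing c ℓ) (φ ψ : Endomorphism (CommutativeRing.ring R)) where
  open CommutativeRing R using (semiring) renaming (ring to R-ring)
  open CommutativeRing R
    using (Carrier; _≈_; _+_; _*_; 0#; 1#; refl; sym; trans; reflexive; *-cong; *-congˡ; *-comm; setoid)
  open Sum semiring
  open SetoidReasoning setoid
  private
    module φ = Endomorphism φ
    module ψ = Endomorphism ψ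
    module X = SkewPolynomial R-ring φ
    module Y = SkewPolynomial R-ring ψ
    module ψ^ n = IsRingHomomorphism (ψ.apply^-isRingHom n)

  star : X.Poly → Y.Poly
  star f = record
    { coeff    = λ n → ψ.apply^ n (X.coeff f n)
    ; bound    = X.bound f
    ; vanishes = λ n le → trans (ψ.apply^-cong n (X.vanishes f n le)) (ψ^.0#-homo n)
    }

  star-cong : ∀ {f g} → f X.≈ₚ g → star f Y.≈ₚ star g
  star-cong p = Y.mk≈ₚ λ n → ψ.apply^-cong n (X.coeff-≈ p n)

  star-+ : ∀ f g → star (f X.+ₚ g) Y.≈ₚ star f Y.+ₚ star g
  star-+ f g = Y.mk≈ₚ λ n → ψ^.+-homo n _ _

  star-constant : ∀ x → star (X.constant x) Y.≈ₚ Y.constant x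
  star-constant x = Y.mk≈ₚ λ { zero → refl ; (suc n) → ψ^.0#-homo (suc n) }

  star-* : (∀ x → ψ.apply (φ.apply x) ≈ x) →
           ∀ f g → star (f X.*ₚ g) Y.≈ₚ star g Y.*ₚ star f
  star-* ψφ f g = Y.mk≈ₚ λ n → begin
    ψ.apply^ n (sum (t n))                      ≈⟨ sum-homo R-ring {S = R-ring} (ψ.apply^-isRingHom n) (t n) ⟩
    sum (λ i → ψ.apply^ n (t n i))              ≈⟨ sum-cong-≋ {suc n} (λ i → step n (toℕ i) (toℕ≤pred[n] i)) ⟩
    sum (λ (i : Fin (suc n)) → u n (n ∸ toℕ i)) ≈⟨ sum-cong-≋ {suc n} (λ i → reflexive (≡.cong (u n) (≡.sym (opposite-prop i)))) ⟩
    sum (λ (i : Fin (suc n)) → u n (toℕ (reverse ⟨$⟩ʳ i)))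
                                                ≈⟨ sum-permute {suc n} (u n ∘ toℕ) reverse ⟨
    sum (u n ∘ toℕ {suc n})                     ∎
    where
    t : ∀ n → Fin (suc n) → Carrier
    t n i = X.coeff f (toℕ i) * φ.apply^ (toℕ i) (X.coeff g (n ∸ toℕ i))

    u : ℕ → ℕ → Carrier
    u n j = Y.coeff (star g) j * ψ.apply^ j (Y.coeff (star f) (n ∸ j))

    ψφ^ : ∀ i x → ψ.apply^ i (φ.apply^ i x) ≈ x
    ψφ^ zero    x = refl
    ψφ^ (suc i) x = begin
      ψ.apply^ i (ψ.apply (φ.apply^ i (φ.apply x)))  ≡⟨ ≡.cong (λ y → ψ.apply^ i (ψ.apply y)) (φ.apply^-suc i x) ⟩
      ψ.apply^ i (ψ.apply (φ.apply (φ.apply^ i x)))  ≈⟨ ψ.apply^-cong i (ψφ _) ⟩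
      ψ.apply^ i (φ.apply^ i x)                      ≈⟨ ψφ^ i x ⟩
      x                                              ∎

    step : ∀ n i → i ≤ n →
           ψ.apply^ n (X.coeff f i * φ.apply^ i (X.coeff g (n ∸ i))) ≈ u n (n ∸ i)
    step n i i≤n = begin
      ψ.apply^ n (aᵢ * φ.apply^ i b)
        ≈⟨ ψ^.*-homo n _ _ ⟩
      ψ.apply^ n aᵢ * ψ.apply^ n (φ.apply^ i b)
        ≈⟨ *-comm _ _ ⟩
      ψ.apply^ n (φ.apply^ i b) * ψ.apply^ n aᵢ
        ≡⟨ ≡.cong₂ _*_ (split _) (split _) ⟩
      ψ.apply^ (n ∸ i) (ψ.apply^ i (φ.apply^ i b)) * ψ.apply^ (n ∸ i) (ψ.apply^ i aᵢ)
        ≈⟨ *-cong (ψ.apply^-cong (n ∸ i) (ψφ^ i b)) refl ⟩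
      ψ.apply^ (n ∸ i) b * ψ.apply^ (n ∸ i) (ψ.apply^ i aᵢ)
        ≡⟨ ≡.cong (λ k → ψ.apply^ (n ∸ i) b * ψ.apply^ (n ∸ i) (Y.coeff (star f) k)) (ℕₚ.m∸[m∸n]≡n i≤n) ⟨
      ψ.apply^ (n ∸ i) b * ψ.apply^ (n ∸ i) (Y.coeff (star f) (n ∸ (n ∸ i))) ∎
      where
      aᵢ = X.coeff f i
      b  = X.coeff g (n ∸ i)
      split : ∀ x → ψ.apply^ n x ≡ ψ.apply^ (n ∸ i) (ψ.apply^ i x)
      split x = ≡.trans (≡.cong (λ k → ψ.apply^ k x) (≡.sym (ℕₚ.m+[n∸m]≡n i≤n)))
                        (ψ.apply^-+ i (n ∸ i) x)

module Polynomial (R : CommutativeRing c ℓ) where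
  open CommutativeRing R using (reflexive; refl; sym; trans) renaming (ring to R-ring)
  open SkewPolynomial R-ring (idEndomorphism R-ring) public

  private
    open Star R (idEndomorphism R-ring) (idEndomorphism R-ring)

    iterate-id : ∀ n {A : Set c} (x : A) → iterate id x n ≡ x
    iterate-id zero    x = ≡.refl
    iterate-id (suc n) x = iterate-id n x

    star-id : ∀ f → star f ≈ₚ f
    star-id f = mk≈ₚ λ n → reflexive (iterate-id n _)

  commutativeRing : CommutativeRing (c ⊔ ℓ) ℓ
  commutativeRing = record
    { isCommutativeRing = record { isRing = Ring.isRing ring ; *-comm = *-comm } }
    where
    module P = Ring ring
    *-comm : ∀ f g → f *ₚ g ≈ₚ g *ₚ f
    *-comm f g = P.trans (P.sym (star-id (f *ₚ g)))
      (P.trans (star-* (λ _ → refl) f g) (P.*-cong (star-id g) (star-id f)))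

module Matrix (R : Ring c ℓ) where
  open Ring R
  open Sum semiring
  open SetoidReasoning setoid

  infix  4 _≈ᴹ_
  infixl 6 _+ᴹ_ _-ᴹ_
  infixl 7 _*ᴹ_
  infixr 7 _·ᴹ_
  infix  8 -ᴹ_

  Mat : ℕ → ℕ → Set c
  Mat m n = Fin m → Fin n → Carrier

  _≈ᴹ_ : ∀ {m n} → Mat m n → Mat m n → Set ℓ
  A ≈ᴹ B = ∀ i j → A i j ≈ B i j

  _+ᴹ_ : ∀ {m n} → Mat m n → Mat m n → Mat m n
  (A +ᴹ B) i j = A i j + B i j

  -ᴹ_ : ∀ {m n} → Mat m n → Mat m n
  (-ᴹ A) i j = - A i j

  _-ᴹ_ : ∀ {m n} → Mat m n → Mat m n → Mat m n
  A -ᴹ B = A +ᴹ -ᴹ B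

  0ᴹ : ∀ {m n} → Mat m n
  0ᴹ i j = 0#

  _·ᴹ_ : ∀ {m n} → Carrier → Mat m n → Mat m n
  (x ·ᴹ A) i j = x * A i j

  _*ᴹ_ : ∀ {l m n} → Mat l m → Mat m n → Mat l n
  _*ᴹ_ {m = m} A B i k = ∑[ j < m ] (A i j * B j k)

  scalar : ∀ {n} → Carrier → Mat n n
  scalar x zero    zero    = x
  scalar x zero    (suc j) = 0#
  scalar x (suc i) zero    = 0#
  scalar x (suc i) (suc j) = scalar x i j

  abelianGroup : ℕ → ℕ → AbelianGroup c ℓ
  abelianGroup m n = record
    { Carrier        = Mat m n
    ; _≈_            = _≈ᴹ_
    ; _∙_            = _+ᴹ_
    ; ε              = 0ᴹ
    ; _⁻¹            = -ᴹ_
    ; isAbelianGroup = Pointwise.isAbelianGroup (Fin m) (Pointwise.isAbelianGroup (Fin n) +-isAbelianGroup)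
    }

  private
    sum≈ : ∀ n (s t : Fin n → Carrier) → (∀ i → s i ≈ t i) → sum s ≈ sum t
    sum≈ n s t = sum-cong-≋ {n} {s} {t}

    sum0 : ∀ n (t : Fin n → Carrier) → (∀ i → t i ≈ 0#) → sum t ≈ 0#
    sum0 n t eq = trans (sum≈ n t _ eq) (sum-replicate-zero n)

  scalar-cong : ∀ {n x y} → x ≈ y → scalar {n} x ≈ᴹ scalar y
  scalar-cong eq zero    zero    = eq
  scalar-cong eq zero    (suc j) = refl
  scalar-cong eq (suc i) zero    = refl
  scalar-cong eq (suc i) (suc j) = scalar-cong eq i j

  *ᴹ-cong : ∀ {l m n} {A A′ : Mat l m} {B B′ : Mat m n} →
            A ≈ᴹ A′ → B ≈ᴹ B′ → A *ᴹ B ≈ᴹ A′ *ᴹ B′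
  *ᴹ-cong p q i k = sum≈ _ _ _ λ j → *-cong (p i j) (q j k)

  *ᴹ-assoc : ∀ {k l m n} (A : Mat k l) (B : Mat l m) (C : Mat m n) →
             (A *ᴹ B) *ᴹ C ≈ᴹ A *ᴹ (B *ᴹ C)
  *ᴹ-assoc {k} {l} {m} {n} A B C i h = begin
    ∑[ j′ < m ] (∑[ j < l ] (A i j * B j j′) * C j′ h)
      ≈⟨ sum≈ m _ _ (λ j′ → *-distribʳ-sum (C j′ h) (λ j → A i j * B j j′)) ⟩
    ∑[ j′ < m ] ∑[ j < l ] (A i j * B j j′ * C j′ h)
      ≈⟨ ∑-comm (λ j′ j → A i j * B j j′ * C j′ h) ⟩
    ∑[ j < l ] ∑[ j′ < m ] (A i j * B j j′ * C j′ h)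
      ≈⟨ sum≈ l _ _ (λ j → sum≈ m _ _ (λ j′ → *-assoc (A i j) (B j j′) (C j′ h))) ⟩
    ∑[ j < l ] ∑[ j′ < m ] (A i j * (B j j′ * C j′ h))
      ≈⟨ sum≈ l _ _ (λ j → sym (*-distribˡ-sum (A i j) (λ j′ → B j j′ * C j′ h))) ⟩
    ∑[ j < l ] (A i j * ∑[ j′ < m ] (B j j′ * C j′ h)) ∎

  *ᴹ-distribˡ : ∀ {l m n} (A : Mat l m) (B C : Mat m n) →
                A *ᴹ (B +ᴹ C) ≈ᴹ A *ᴹ B +ᴹ A *ᴹ C
  *ᴹ-distribˡ {m = m} A B C i k =
    trans (sum≈ m _ _ λ j → distribˡ (A i j) (B j k) (C j k)) (∑-distrib-+ {m} _ _)

  *ᴹ-distribʳ : ∀ {l m n} (C : Mat m n) (A B : Mat l m) →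
                (A +ᴹ B) *ᴹ C ≈ᴹ A *ᴹ C +ᴹ B *ᴹ C
  *ᴹ-distribʳ {m = m} C A B i k =
    trans (sum≈ m _ _ λ j → distribʳ (C j k) (A i j) (B i j)) (∑-distrib-+ {m} _ _)

  *ᴹ-zeroˡ : ∀ {l m n} (B : Mat m n) → 0ᴹ {l} *ᴹ B ≈ᴹ 0ᴹ
  *ᴹ-zeroˡ {m = m} B i k = sum0 m _ λ j → zeroˡ _

  *ᴹ-zeroʳ : ∀ {l m n} (A : Mat l m) → A *ᴹ 0ᴹ {m} {n} ≈ᴹ 0ᴹ
  *ᴹ-zeroʳ {m = m} A i k = sum0 m _ λ j → zeroʳ _

  -ᴹ-distribˡ : ∀ {l m n} (A : Mat l m) (B : Mat m n) → -ᴹ (A *ᴹ B) ≈ᴹ (-ᴹ A) *ᴹ B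
  -ᴹ-distribˡ {l} {m} {n} A B = G.sym (G.inverseˡ-unique _ _
    (G.trans (G.sym (*ᴹ-distribʳ B (-ᴹ A) A))
      (G.trans (*ᴹ-cong {B = B} (λ i j → -‿inverseˡ (A i j)) (λ _ _ → refl)) (*ᴹ-zeroˡ B))))
    where
    module G where
      open AbelianGroup (abelianGroup l n) public
      open AbelianGroupProperties (abelianGroup l n) public

  -ᴹ-distribʳ : ∀ {l m n} (A : Mat l m) (B : Mat m n) → -ᴹ (A *ᴹ B) ≈ᴹ A *ᴹ (-ᴹ B)
  -ᴹ-distribʳ {l} {m} {n} A B = G.sym (G.inverseˡ-unique _ _
    (G.trans (G.sym (*ᴹ-distribˡ A (-ᴹ B) B))
      (G.trans (*ᴹ-cong {A = A} (λ _ _ → refl) (λ i j → -‿inverseˡ (B i j))) (*ᴹ-zeroʳ A))))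
    where
    module G where
      open AbelianGroup (abelianGroup l n) public
      open AbelianGroupProperties (abelianGroup l n) public

  scalar-*ᴹ : ∀ {m n} x (A : Mat m n) → scalar x *ᴹ A ≈ᴹ x ·ᴹ A
  scalar-*ᴹ {suc m} x A zero k =
    trans (+-congˡ (sum0 m _ λ j → zeroˡ _)) (+-identityʳ _)
  scalar-*ᴹ {suc m} x A (suc i) k =
    trans (+-cong (zeroˡ _) (scalar-*ᴹ x (A ∘ suc) i k)) (+-identityˡ _)

  *ᴹ-scalar : ∀ {m n} x (A : Mat m n) i j → (A *ᴹ scalar x) i j ≈ A i j * x
  *ᴹ-scalar {n = suc n} x A i zero =
    trans (+-congˡ (sum0 n _ λ j → zeroʳ _)) (+-identityʳ _)
  *ᴹ-scalar {n = suc n} x A i (suc j) =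
    trans (+-cong (zeroʳ _) (*ᴹ-scalar x (λ i j → A i (suc j)) i j)) (+-identityˡ _)

  matrixRing : ℕ → Ring c ℓ
  matrixRing n = record
    { Carrier = Mat n n
    ; _≈_     = _≈ᴹ_
    ; _+_     = _+ᴹ_
    ; _*_     = _*ᴹ_
    ; -_      = -ᴹ_
    ; 0#      = 0ᴹ
    ; 1#      = scalar 1#
    ; isRing  = record
      { +-isAbelianGroup = AbelianGroup.isAbelianGroup (abelianGroup n n)
      ; *-cong     = λ {A} {A′} {B} {B′} → *ᴹ-cong {A = A} {A′} {B} {B′}
      ; *-assoc    = *ᴹ-assoc
      ; *-identity = (λ A i j → trans (scalar-*ᴹ 1# A i j) (*-identityˡ _))
                   , (λ A i j → trans (*ᴹ-scalar 1# A i j) (*-identityʳ _))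
      ; distrib    = *ᴹ-distribˡ , *ᴹ-distribʳ
      }
    }

-- M ↦ the transpose of (f applied entrywise to M).

module TransposeMap (R : Ring c₁ ℓ₁) (S : Ring c₂ ℓ₂) (f : Ring.Carrier R → Ring.Carrier S) where
  private
    module R = Ring R
    module S = Ring S
    module MR = Matrix R
    module MS = Matrix S
    module ΣR = Sum R.semiring
    module ΣS = Sum S.semiring

  transposeMap : ∀ {m n} → MR.Mat m n → MS.Mat n m
  transposeMap A j i = f (A i j)

  module _ (f-cong : ∀ {x y} → x R.≈ y → f x S.≈ f y)
           (f-0    : f R.0# S.≈ S.0#)
           (f-+    : ∀ x y → f (x R.+ y) S.≈ f x S.+ f y)
           (f-*    : ∀ x y → f (x R.* y) S.≈ f y S.* f x) where

    private
      f-sum : ∀ n (t : Fin n → R.Carrier) → f (ΣR.sum t) S.≈ ΣS.sum (f ∘ t)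
      f-sum zero    t = f-0
      f-sum (suc n) t = S.trans (f-+ _ _) (S.+-congˡ (f-sum n (t ∘ suc)))

    transposeMap-* : ∀ {l m n} (A : MR.Mat l m) (B : MR.Mat m n) →
      transposeMap (A MR.*ᴹ B) MS.≈ᴹ transposeMap B MS.*ᴹ transposeMap A
    transposeMap-* {m = m} A B k i = S.trans (f-sum m _)
      (ΣS.sum-cong-≋ {m} {λ j → f (A i j R.* B j k)} {λ j → f (B j k) S.* f (A i j)}
        λ j → f-* (A i j) (B j k))

    transposeMap-scalar : ∀ {n x y} → f x S.≈ y → transposeMap (MR.scalar {n} x) MS.≈ᴹ MS.scalar y
    transposeMap-scalar eq zero    zero    = eq
    transposeMap-scalar eq zero    (suc j) = f-0
    transposeMap-scalar eq (suc i) zero    = f-0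
    transposeMap-scalar eq (suc i) (suc j) = transposeMap-scalar eq i j

module FieldLemmas (K : HeytingField c ℓ₁ ℓ₂) where
  open HeytingField K using (_#_; heytingCommutativeRing; #⇒invertible; invertible⇒#; #-irrefl; tight)
  commutativeRing : CommutativeRing c ℓ₁
  commutativeRing = HeytingCommutativeRing.commutativeRing heytingCommutativeRing
  open CommutativeRing commutativeRing public hiding (zero)
  open Exp semiring using (_^_)
  open AbelianGroupProperties +-abelianGroup
    using (x∙y⁻¹≈ε⇒x≈y) renaming (ε⁻¹≈ε to -0≈0)
  open CommutativeSemigroupProperties *-commutativeSemigroup using (interchange)

  Unit : Carrier → Set (c ⊔ ℓ₁)
  Unit x = ∃ λ y → y * x ≈ 1#

  Unit-resp : ∀ {x y} → x ≈ y → Unit x → Unit y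
  Unit-resp eq (z , zx≈1) = z , trans (*-congˡ (sym eq)) zx≈1

  1-Unit : Unit 1#
  1-Unit = 1# , *-identityˡ 1#

  *-Unit : ∀ {x y} → Unit x → Unit y → Unit (x * y)
  *-Unit (x′ , p) (y′ , q) =
    x′ * y′ , trans (interchange x′ y′ _ _) (trans (*-cong p q) (*-identityˡ 1#))

  ^-Unit : ∀ n {x} → Unit x → Unit (x ^ n)
  ^-Unit zero    u = 1-Unit
  ^-Unit (suc n) u = *-Unit u (^-Unit n u)

  Unit⇒#0 : ∀ {x} → Unit x → x # 0#
  Unit⇒#0 {x} u = invertible⇒# (invertible (Unit-resp (sym x-0≈x) u))
    where
    x-0≈x : x - 0# ≈ x
    x-0≈x = trans (+-congˡ -0≈0) (+-identityʳ x)
    invertible : ∀ {z} → Unit z → Invertible _≈_ 1# _*_ z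
    invertible (y , p) = y , p , trans (*-comm _ _) p

  ¬0-Unit : ¬ Unit 0#
  ¬0-Unit u = #-irrefl refl (Unit⇒#0 u)

  ¬Unit-⇒≈ : ∀ {x y} → ¬ Unit (x - y) → x ≈ y
  ¬Unit-⇒≈ {x} {y} ¬u = proj₁ (tight x y) λ x#y →
    let (z , p , _) = #⇒invertible x#y in ¬u (z , p)

  ¬Unit⇒≈0 : ∀ {x} → ¬ Unit x → x ≈ 0#
  ¬Unit⇒≈0 {x} ¬u = ¬Unit-⇒≈ λ u → ¬u (Unit-resp (trans (+-congˡ -0≈0) (+-identityʳ x)) u)

  ^-reduced : ∀ n {x} → x ^ n ≈ 0# → x ≈ 0#
  ^-reduced n xⁿ≈0 = ¬Unit⇒≈0 λ u → ¬0-Unit (Unit-resp xⁿ≈0 (^-Unit n u))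

-- A finite field with q = pˢ elements; the case s = 0 is vacuous since 0# and 1# are distinct.

record FiniteField (c ℓ₁ ℓ₂ : Level) : Set (lsuc (c ⊔ ℓ₁ ⊔ ℓ₂)) where
  field
    heytingField : HeytingField c ℓ₁ ℓ₂
    p s          : ℕ
    p-prime      : Prime p

  q : ℕ
  q = p ℕ.^ s

  open FieldLemmas heytingField public

  field
    enumeration : Inverse setoid (≡.setoid (Fin q))

  private
    open Exp semiring using (_^_; ^-congˡ)
    open SetoidReasoning setoid
    module enum = Inverse enumeration
    open CommutativeMonoidSum *-commutativeMonoid
      using () renaming
      ( sum to product; sum-cong-≋ to product-cong; sum-permute to product-permute
      ; ∑-distrib-+ to product-distrib; sum-replicate to product-replicate )

    Unit? : ∀ x → Dec (Unit x)
    Unit? x with any? (λ i → enum.to (enum.from i * x) ≟ enum.to 1#)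
    ... | yes (i , eq) = yes (enum.from i ,
            trans (sym (enum.inverseʳ ≡.refl)) (trans (enum.from-cong eq) (enum.inverseʳ ≡.refl)))
    ... | no ¬∃ = no λ (y , yx≈1) → ¬∃ (enum.to y ,
            enum.to-cong (trans (*-congʳ (enum.inverseʳ ≡.refl)) yx≈1))

    -- pick x u v is u if x ≈ 0# and v otherwise
    pick : Carrier → Carrier → Carrier → Carrier
    pick x u v with Unit? x
    ... | yes _ = v
    ... | no  _ = u

    product-Unit : ∀ n (t : Fin n → Carrier) → (∀ i → Unit (t i)) → Unit (product t)
    product-Unit zero    t u = 1-Unit
    product-Unit (suc n) t u = *-Unit (u zero) (product-Unit n (t ∘ suc) (u ∘ suc))

    product-1 : ∀ n (t : Fin n → Carrier) → (∀ i → t i ≈ 1#) → product t ≈ 1#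
    product-1 zero    t eq = refl
    product-1 (suc n) t eq = trans (*-cong (eq zero) (product-1 n (t ∘ suc) (eq ∘ suc))) (*-identityˡ 1#)

    product-single : ∀ n (i : Fin n) (t : Fin n → Carrier) →
                     (∀ j → ¬ j ≡ i → t j ≈ 1#) → product t ≈ t i
    product-single (suc n) zero t eq =
      trans (*-congˡ (product-1 n (t ∘ suc) λ j → eq (suc j) λ ())) (*-identityʳ _)
    product-single (suc n) (suc i) t eq =
      trans (*-cong (eq zero λ ()) (product-single n i (t ∘ suc) λ j j≢i → eq (suc j) λ { ≡.refl → j≢i ≡.refl }))
            (*-identityˡ _)

    *-cancel-Unit : ∀ {x} y → Unit x → y * x ≈ x → y ≈ 1#
    *-cancel-Unit {x} y (z , zx≈1) yx≈x = begin
      y            ≈⟨ *-identityʳ y ⟨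
      y * 1#       ≈⟨ *-congˡ xz≈1 ⟨
      y * (x * z)  ≈⟨ *-assoc y x z ⟨
      y * x * z    ≈⟨ *-congʳ yx≈x ⟩
      x * z        ≈⟨ xz≈1 ⟩
      1#           ∎
      where
      xz≈1 : x * z ≈ 1#
      xz≈1 = trans (*-comm x z) zx≈1

    fermat-Unit : ∀ x → Unit x → x ^ q ≈ x
    fermat-Unit x ux@(x′ , x′x≈1) = begin
      x ^ q                               ≈⟨ product-replicate q ⟨
      product {q} (λ _ → x)               ≈⟨ product-cong {q} (λ i → h*k (enum.from i)) ⟨
      product {q} (λ i → h (enum.from i) * k (enum.from i))
                                          ≈⟨ product-distrib {q} (h ∘ enum.from) (k ∘ enum.from) ⟩
      product {q} (h ∘ enum.from) * product {q} (k ∘ enum.from)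
                                          ≈⟨ *-cong product-h product-k ⟩
      1# * x                              ≈⟨ *-identityˡ x ⟩
      x                                   ∎
      where
      g h k : Carrier → Carrier
      g y = pick y 1# y
      h y = pick y 1# x
      k y = pick y x 1#

      h*k : ∀ y → h y * k y ≈ x
      h*k y with Unit? y
      ... | yes _ = *-identityʳ x
      ... | no  _ = *-identityˡ x

      g-Unit : ∀ y → Unit (g y)
      g-Unit y with Unit? y
      ... | yes u = u
      ... | no  _ = 1-Unit

      g-cong : ∀ {y z} → y ≈ z → g y ≈ g z
      g-cong {y} {z} eq with Unit? y | Unit? z
      ... | yes _ | yes _ = eq
      ... | no  _ | no  _ = refl
      ... | yes u | no ¬u = contradiction (Unit-resp eq u) ¬u
      ... | no ¬u | yes u = contradiction (Unit-resp (sym eq) u) ¬u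

      g-* : ∀ y → g (x * y) ≈ h y * g y
      g-* y with Unit? (x * y) | Unit? y
      ... | yes _ | yes _ = refl
      ... | no  _ | no  _ = sym (*-identityˡ 1#)
      ... | no ¬u | yes u = contradiction (*-Unit ux u) ¬u
      ... | yes (z , p) | no ¬u = contradiction (z * x , trans (*-assoc z x y) p) ¬u

      π : Permutation′ q
      π = permutation (λ i → enum.to (x * enum.from i)) (λ i → enum.to (x′ * enum.from i))
            (λ i → enum.inverseˡ (trans (*-congˡ (enum.inverseʳ ≡.refl)) (cancel x x′ (trans (*-comm x x′) x′x≈1) i)))
            (λ i → enum.inverseˡ (trans (*-congˡ (enum.inverseʳ ≡.refl)) (cancel x′ x x′x≈1 i)))
        where
        cancel : ∀ u v → u * v ≈ 1# → ∀ i → u * (v * enum.from i) ≈ enum.from i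
        cancel u v uv≈1 i = trans (sym (*-assoc u v _)) (trans (*-congʳ uv≈1) (*-identityˡ _))

      product-h : product {q} (h ∘ enum.from) ≈ 1#
      product-h = *-cancel-Unit _ (product-Unit q (g ∘ enum.from) (g-Unit ∘ enum.from)) (begin
        product (h ∘ enum.from) * product (g ∘ enum.from)
          ≈⟨ product-distrib {q} (h ∘ enum.from) (g ∘ enum.from) ⟨
        product {q} (λ i → h (enum.from i) * g (enum.from i))
          ≈⟨ product-cong {q} (λ i → g-* (enum.from i)) ⟨
        product {q} (λ i → g (x * enum.from i))
          ≈⟨ product-cong {q} (λ i → g-cong (enum.inverseʳ ≡.refl)) ⟨
        product {q} (λ i → g (enum.from (π ⟨$⟩ʳ i)))
          ≈⟨ product-permute {q} (g ∘ enum.from) π ⟨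
        product (g ∘ enum.from) ∎)

      product-k : product {q} (k ∘ enum.from) ≈ x
      product-k = trans (product-single q (enum.to 0#) (k ∘ enum.from) k-other) k-zero
        where
        k-other : ∀ j → ¬ j ≡ enum.to 0# → k (enum.from j) ≈ 1#
        k-other j j≢0 with Unit? (enum.from j)
        ... | yes _ = refl
        ... | no ¬u = contradiction (≡.trans (≡.sym (enum.inverseˡ refl)) (enum.to-cong (¬Unit⇒≈0 ¬u))) j≢0
        k-zero : k (enum.from (enum.to 0#)) ≈ x
        k-zero with Unit? (enum.from (enum.to 0#))
        ... | yes u = contradiction (Unit-resp (enum.inverseʳ ≡.refl) u) ¬0-Unit
        ... | no  _ = refl

  x^q≈x : ∀ x → x ^ q ≈ x
  x^q≈x x with Unit? x
  ... | yes u = fermat-Unit x u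
  ... | no ¬u = trans (^-congˡ q x≈0) (trans (0^q q (enum.to 0#)) (sym x≈0))
    where
    x≈0 = ¬Unit⇒≈0 ¬u
    0^q : ∀ n → Fin n → 0# ^ n ≈ 0#
    0^q (suc n) _ = zeroˡ _

private
  p∤n! : ∀ {p} → Prime p → ∀ n → n < p → ¬ p ∣ n !
  p∤n! {p} pp zero n<p p∣1 = contradiction (∣⇒≤ p∣1) (ℕₚ.<⇒≱ (ℕ.nonTrivial⇒n>1 p))
    where instance _ = prime⇒nonTrivial pp
  p∤n! pp (suc n) n<p p∣n! with euclidsLemma (suc n) (n !) pp p∣n!
  ... | inj₁ p∣sn = contradiction (∣⇒≤ p∣sn) (ℕₚ.<⇒≱ n<p)
  ... | inj₂ p∣n  = p∤n! pp n (ℕₚ.<-trans (ℕₚ.n<1+n n) n<p) p∣n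

  p∣pCk : ∀ {p} → Prime p → ∀ k → 0 < k → k < p → p ∣ p C k
  p∣pCk {p} pp k 0<k k<p with euclidsLemma (p C k) (k ! ℕ.* (p ∸ k) !) pp p∣product
    where
    instance _ = k ℕₚ.!* (p ∸ k) !≢0
    p∣p! : ∀ p → 0 < p → p ∣ p !
    p∣p! (suc p) _ = ∣m⇒∣m*n (p !) ∣-refl
    p∣product : p ∣ (p C k) ℕ.* (k ! ℕ.* (p ∸ k) !)
    p∣product = ≡.subst (p ∣_)
      (≡.sym (≡.trans (≡.cong (ℕ._* (k ! ℕ.* (p ∸ k) !)) (nCk≡n!/k![n-k]! (ℕₚ.<⇒≤ k<p)))
                      (m/n*n≡m (k![n∸k]!∣n! (ℕₚ.<⇒≤ k<p)))))
      (p∣p! p (ℕₚ.<-trans 0<k k<p))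
  ... | inj₁ p∣C = p∣C
  ... | inj₂ p∣rest with euclidsLemma (k !) ((p ∸ k) !) pp p∣rest
  ...   | inj₁ p∣k! = contradiction p∣k! (p∤n! pp k k<p)
  ...   | inj₂ p∣r! = contradiction p∣r! (p∤n! pp (p ∸ k) (ℕₚ.∸-monoʳ-< 0<k (ℕₚ.<⇒≤ k<p)))

module Frobenius (R : CommutativeRing c ℓ) (p : ℕ) (p-prime : Prime p) where
  open CommutativeRing R hiding (zero)
  open CommutativeExp commutativeSemiring
  open Mult semiring using () renaming (_×_ to _×ᴿ_; ×-assocˡ to ×ᴿ-assocˡ; ×-assoc-* to ×ᴿ-assoc-*; ×-congʳ to ×ᴿ-congʳ; ×-homo-1 to ×ᴿ-homo-1; ×-congˡ to ×ᴿ-congˡ)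
  open Sum semiring
  open SetoidReasoning setoid

  module _ (char-p : p ×ᴿ 1# ≈ 0#) where
    private
      ∣⇒×≈0 : ∀ {m} → p ∣ m → ∀ x → m ×ᴿ x ≈ 0#
      ∣⇒×≈0 (divides-refl k) x = begin
        (k ℕ.* p) ×ᴿ x      ≈⟨ ×ᴿ-assocˡ x k p ⟨
        k ×ᴿ (p ×ᴿ x)       ≈⟨ ×ᴿ-congʳ k p×x≈0 ⟩
        k ×ᴿ 0#             ≈⟨ k×0 k ⟩
        0#                  ∎
        where
        p×x≈0 : p ×ᴿ x ≈ 0#
        p×x≈0 = begin
          p ×ᴿ x            ≈⟨ ×ᴿ-congʳ p (*-identityˡ x) ⟨
          p ×ᴿ (1# * x)     ≈⟨ ×ᴿ-assoc-* p 1# x ⟨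
          (p ×ᴿ 1#) * x     ≈⟨ *-congʳ char-p ⟩
          0# * x            ≈⟨ zeroˡ x ⟩
          0#                ∎
        k×0 : ∀ k → k ×ᴿ 0# ≈ 0#
        k×0 zero    = refl
        k×0 (suc k) = trans (+-identityˡ _) (k×0 k)

      freshman : ∀ n → p ≡ suc n → ∀ x y → (x + y) ^ p ≈ x ^ p + y ^ p
      freshman n ≡.refl x y = begin
        (x + y) ^ p                          ≈⟨ Binomial.theorem commutativeSemiring p x y ⟩
        t zero + sum (t ∘ suc)               ≈⟨ +-cong first (sum-init-last (t ∘ suc)) ⟩
        y ^ p + (sum (λ i → t (suc (inject₁ i))) + t (suc (fromℕ n)))
                                             ≈⟨ +-congˡ (+-cong middle last′) ⟩
        y ^ p + (0# + x ^ p)                 ≈⟨ +-congˡ (+-identityˡ _) ⟩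
        y ^ p + x ^ p                        ≈⟨ +-comm _ _ ⟩
        x ^ p + y ^ p                        ∎
        where
        t : Fin (suc p) → Carrier
        t k = (p C toℕ k) ×ᴿ (x ^ toℕ k * y ^ (p ∸ toℕ k))

        first : t zero ≈ y ^ p
        first = trans (×ᴿ-homo-1 _) (*-identityˡ _)

        middle : sum (λ i → t (suc (inject₁ i))) ≈ 0#
        middle = trans (sum-cong-≋ {n} {λ i → t (suc (inject₁ i))} {λ _ → 0#} λ i →
          ∣⇒×≈0 (p∣pCk p-prime (suc (toℕ (inject₁ i))) (s≤s ℕ.z≤n)
                  (s≤s (≡.subst (_< n) (≡.sym (toℕ-inject₁ i)) (toℕ<n i)))) _)
          (sum-replicate-zero n)

        last′ : t (suc (fromℕ n)) ≈ x ^ p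
        last′ = begin
          t (suc (fromℕ n))
            ≡⟨ ≡.cong (λ k → (p C suc k) ×ᴿ (x ^ suc k * y ^ (n ∸ k))) (toℕ-fromℕ n) ⟩
          (p C p) ×ᴿ (x ^ p * y ^ (n ∸ n))
            ≡⟨ ≡.cong₂ (λ a b → a ×ᴿ (x ^ p * y ^ b)) (nCn≡1 p) (ℕₚ.n∸n≡0 n) ⟩
          1 ×ᴿ (x ^ p * 1#)
            ≈⟨ ×ᴿ-homo-1 _ ⟩
          x ^ p * 1#
            ≈⟨ *-identityʳ _ ⟩
          x ^ p ∎

      ^p-homo-+ : ∀ x y → (x + y) ^ p ≈ x ^ p + y ^ p
      ^p-homo-+ = freshman (ℕ.pred p) (≡.sym (ℕₚ.suc-pred p))
        where instance _ = prime⇒nonZero p-prime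

      ^pˢ-homo-+ : ∀ s x y → (x + y) ^ (p ℕ.^ s) ≈ x ^ (p ℕ.^ s) + y ^ (p ℕ.^ s)
      ^pˢ-homo-+ zero x y =
        trans (*-identityʳ _) (sym (+-cong (*-identityʳ x) (*-identityʳ y)))
      ^pˢ-homo-+ (suc s) x y = begin
        (x + y) ^ (p ℕ.* p ℕ.^ s)         ≈⟨ ^-assocʳ (x + y) p (p ℕ.^ s) ⟨
        ((x + y) ^ p) ^ (p ℕ.^ s)         ≈⟨ ^-congˡ (p ℕ.^ s) (^p-homo-+ x y) ⟩
        (x ^ p + y ^ p) ^ (p ℕ.^ s)       ≈⟨ ^pˢ-homo-+ s (x ^ p) (y ^ p) ⟩
        (x ^ p) ^ (p ℕ.^ s) + (y ^ p) ^ (p ℕ.^ s)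
                                          ≈⟨ +-cong (^-assocʳ x p (p ℕ.^ s)) (^-assocʳ y p (p ℕ.^ s)) ⟩
        x ^ (p ℕ.* p ℕ.^ s) + y ^ (p ℕ.* p ℕ.^ s) ∎

    1^n : ∀ n → 1# ^ n ≈ 1#
    1^n zero    = refl
    1^n (suc n) = trans (*-identityˡ _) (1^n n)

    ^pˢ-isRingHom : ∀ s → IsRingHom ring ring (_^ (p ℕ.^ s))
    ^pˢ-isRingHom s = mkIsRingHom ring ring _ (^-congˡ (p ℕ.^ s)) (^pˢ-homo-+ s)
      (λ x y → ^-distrib-* x y (p ℕ.^ s)) (1^n (p ℕ.^ s))

  ^pˢ-root : Surjective _≈_ _≈_ (_^ p) → ∀ s x → ∃ λ y → y ^ (p ℕ.^ s) ≈ x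
  ^pˢ-root perfect zero    x = x , *-identityʳ x
  ^pˢ-root perfect (suc s) x with ^pˢ-root perfect s x
  ... | y , yᵖ≈x with perfect y
  ...   | z , zᵖ≈y = z , (begin
    z ^ (p ℕ.* p ℕ.^ s)   ≈⟨ ^-assocʳ z p (p ℕ.^ s) ⟨
    (z ^ p) ^ (p ℕ.^ s)   ≈⟨ ^-congˡ (p ℕ.^ s) (zᵖ≈y refl) ⟩
    y ^ (p ℕ.^ s)         ≈⟨ yᵖ≈x ⟩
    x                     ∎)

module _ (F : FiniteField c₁ ℓ₁ ℓ₂) where
  private module F = FiniteField F

  Fq[t] : CommutativeRing (c₁ ⊔ ℓ₁) ℓ₁
  Fq[t] = Polynomial.commutativeRing F.commutativeRing

  record AField (c ℓ ℓ′ : Level) : Set (lsuc (c ⊔ ℓ ⊔ ℓ′) ⊔ c₁ ⊔ ℓ₁) where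
    private
      module A = CommutativeRing Fq[t]
      module F[t] = Polynomial F.commutativeRing

    field
      heytingField : HeytingField c ℓ ℓ′

    open FieldLemmas heytingField public
    open Mult semiring using () renaming (_×_ to _×ᴷ_)

    field
      char-p      : F.p ×ᴷ 1# ≈ 0#
      -- the F-algebra structure of K
      η           : F.Carrier → Carrier
      η-isRingHom : IsRingHom F.ring ring η
      ι           : A.Carrier → Carrier
      ι-isRingHom : IsRingHom A.ring ring ι
      ι-constant  : ∀ x → ι (F[t].constant x) ≈ η x

    θ : Carrier
    θ = ι F[t].variable-X

module _ {F : FiniteField c₁ ℓ₁ ℓ₂} {ℓ′ : Level} (K : AField F c ℓ ℓ′) where
  private
    module F = FiniteField F
    module K = AField K
    open Exp K.semiring using (_^_; ^-congˡ)
    module Fexp = Exp F.semiring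
    module Frob = Frobenius K.commutativeRing F.p F.p-prime

  IsPerfect : Set (c ⊔ ℓ)
  IsPerfect = Surjective K._≈_ K._≈_ (_^ F.p)

  -- An endomorphism φ of K fixing F; then K{X} with X x = φ(x) X is an F-algebra.
  record Twist : Set (c₁ ⊔ c ⊔ ℓ) where
    field
      endomorphism : Endomorphism K.ring
      fixes-F      : ∀ x → Endomorphism.apply endomorphism (K.η x) K.≈ K.η x
    open Endomorphism endomorphism public

  private
    η-^ : ∀ x n → K.η x ^ n K.≈ K.η (x Fexp.^ n)
    η-^ x zero    = K.sym (IsRingHomomorphism.1#-homo K.η-isRingHom)
    η-^ x (suc n) = K.trans (K.*-congˡ (η-^ x n)) (K.sym (IsRingHomomorphism.*-homo K.η-isRingHom _ _))

  -- x ↦ x^q, so K{X} for this twist is K{τ}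
  τ : Twist
  τ = record
    { endomorphism = record { apply = _^ F.q ; isRingHom = Frob.^pˢ-isRingHom K.char-p F.s }
    ; fixes-F      = λ x → K.trans (η-^ x F.q)
                       (IsRingHomomorphism.⟦⟧-cong K.η-isRingHom (F.x^q≈x x))
    }

  private module τ = Twist τ

  ^q-injective : ∀ {x y} → x ^ F.q K.≈ y ^ F.q → x K.≈ y
  ^q-injective {x} {y} eq = x∙y⁻¹≈ε⇒x≈y x y (K.^-reduced F.q (begin
    (x K.- y) ^ F.q              ≈⟨ τ.+-homo x (K.- y) ⟩
    x ^ F.q K.+ (K.- y) ^ F.q    ≈⟨ K.+-cong eq (τ.-‿homo y) ⟩
    y ^ F.q K.- y ^ F.q          ≈⟨ K.-‿inverseʳ _ ⟩
    K.0#                         ∎))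
    where
    open AbelianGroupProperties K.+-abelianGroup using (x∙y⁻¹≈ε⇒x≈y)
    open SetoidReasoning K.setoid

  module _ (perfect : IsPerfect) where

    root : K.Carrier → K.Carrier
    root x = proj₁ (Frob.^pˢ-root perfect F.s x)

    root-^q : ∀ x → root x ^ F.q K.≈ x
    root-^q x = proj₂ (Frob.^pˢ-root perfect F.s x)

    ^q-root : ∀ x → root (x ^ F.q) K.≈ x
    ^q-root x = ^q-injective (root-^q (x ^ F.q))

    private
      root-unique : ∀ {x y} → y ^ F.q K.≈ x → root x K.≈ y
      root-unique eq = ^q-injective (K.trans (root-^q _) (K.sym eq))

    -- x ↦ x^(1/q), so K{X} for this twist is K{σ}
    σ : Twist
    σ = record
      { endomorphism = record
        { apply     = root
        ; isRingHom = mkIsRingHom K.ring K.ring root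
            (λ {x} {y} eq → root-unique (K.trans (root-^q y) (K.sym eq)))
            (λ x y → root-unique (K.trans (τ.+-homo _ _) (K.+-cong (root-^q x) (root-^q y))))
            (λ x y → root-unique (K.trans (τ.*-homo _ _) (K.*-cong (root-^q x) (root-^q y))))
            (root-unique τ.1#-homo)
        }
      ; fixes-F = λ x → root-unique (τ.fixes-F x)
      }

-- A and P are algebras over a ring with underlying set S, via κA and κ.

module Biderivation {o : Level} {S : Set o} (A : CommutativeRing c₁ ℓ₁) (P : Ring c ℓ)
                    (κA : S → CommutativeRing.Carrier A) (κ : S → Ring.Carrier P)
                    (κ-central : ∀ x f → Ring._≈_ P (Ring._*_ P (κ x) f) (Ring._*_ P f (κ x))) where
  private
    module A = CommutativeRing A
    module P = Ring P
  open Matrix P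

  -- S-algebra homomorphisms A → Mat_d(P)
  record Representation (d : ℕ) : Set (o ⊔ c₁ ⊔ ℓ₁ ⊔ c ⊔ ℓ) where
    field
      act       : A.Carrier → Mat d d
      isRingHom : IsRingHom A.ring (matrixRing d) act
      act-κ     : ∀ x → act (κA x) ≈ᴹ scalar (κ x)

    open IsRingHomomorphism isRingHom public
      renaming (⟦⟧-cong to act-cong; +-homo to act-+; *-homo to act-*; 1#-homo to act-1; 0#-homo to act-0)

    act-comm : ∀ a b → act a *ᴹ act b ≈ᴹ act b *ᴹ act a
    act-comm a b = M.trans (M.sym (act-* a b)) (M.trans (act-cong (A.*-comm a b)) (act-* b a))
      where module M = Ring (matrixRing d)

  module _ {d e : ℕ} (Φ : Representation d) (Ψ : Representation e) where
    private
      module Φ = Representation Φ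
      module Ψ = Representation Ψ
      module G where
        open AbelianGroup (abelianGroup e d) public
        open AbelianGroupProperties (abelianGroup e d) public
        open CommutativeSemigroupProperties commutativeSemigroup public using (interchange)
      open SetoidReasoning G.setoid

    record Der : Set (o ⊔ c₁ ⊔ ℓ₁ ⊔ c ⊔ ℓ) where
      field
        δ       : A.Carrier → Mat e d
        cong    : ∀ {a b} → a A.≈ b → δ a ≈ᴹ δ b
        +-homo  : ∀ a b → δ (a A.+ b) ≈ᴹ δ a +ᴹ δ b
        ·-homo  : ∀ x a → δ (κA x A.* a) ≈ᴹ κ x ·ᴹ δ a
        leibniz : ∀ a b → δ (a A.* b) ≈ᴹ Ψ.act a *ᴹ δ b +ᴹ δ a *ᴹ Φ.act b
    open Der

    inner : Mat e d → A.Carrier → Mat e d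
    inner U a = U *ᴹ Φ.act a -ᴹ Ψ.act a *ᴹ U

    -- Equality in the quotient Der / Der_in; `inner U` is δ^(U).
    infix 4 _∼_
    record _∼_ (δ₁ δ₂ : Der) : Set (c₁ ⊔ c ⊔ ℓ) where
      constructor mk∼
      field
        matrix   : Mat e d
        is-inner : ∀ a → δ δ₁ a -ᴹ δ δ₂ a ≈ᴹ inner matrix a

    private
      ·ᴹ-cong : ∀ f {A B : Mat e d} → A ≈ᴹ B → f ·ᴹ A ≈ᴹ f ·ᴹ B
      ·ᴹ-cong f p i j = P.*-congˡ (p i j)

      ·ᴹ-+ : ∀ f (A B : Mat e d) → f ·ᴹ (A +ᴹ B) ≈ᴹ f ·ᴹ A +ᴹ f ·ᴹ B
      ·ᴹ-+ f A B i j = P.distribˡ f _ _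

      ·ᴹ-neg : ∀ f (A : Mat e d) → -ᴹ (f ·ᴹ A) ≈ᴹ f ·ᴹ (-ᴹ A)
      ·ᴹ-neg f A i j = RingProperties.-‿distribʳ-* P f _

      ·ᴹ-0 : ∀ f → f ·ᴹ 0ᴹ {e} {d} ≈ᴹ 0ᴹ
      ·ᴹ-0 f i j = P.zeroʳ f

      *ᴹ-·ᴹ : ∀ x (A : Mat e e) (B : Mat e d) → A *ᴹ (κ x ·ᴹ B) ≈ᴹ κ x ·ᴹ (A *ᴹ B)
      *ᴹ-·ᴹ x A B = begin
        A *ᴹ (κ x ·ᴹ B)         ≈⟨ *ᴹ-cong {A = A} (λ _ _ → P.refl) (scalar-*ᴹ (κ x) B) ⟨
        A *ᴹ (scalar (κ x) *ᴹ B) ≈⟨ *ᴹ-assoc A (scalar (κ x)) B ⟨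
        (A *ᴹ scalar (κ x)) *ᴹ B ≈⟨ *ᴹ-cong {B = B} (λ i j → P.trans (*ᴹ-scalar (κ x) A i j) (P.sym (κ-central x _))) (λ _ _ → P.refl) ⟩
        (κ x ·ᴹ A) *ᴹ B          ≈⟨ *ᴹ-cong {B = B} (scalar-*ᴹ (κ x) A) (λ _ _ → P.refl) ⟨
        (scalar (κ x) *ᴹ A) *ᴹ B ≈⟨ *ᴹ-assoc (scalar (κ x)) A B ⟩
        scalar (κ x) *ᴹ (A *ᴹ B) ≈⟨ scalar-*ᴹ (κ x) (A *ᴹ B) ⟩
        κ x ·ᴹ (A *ᴹ B)          ∎

      *ᴹ-congˡ : ∀ {l m n} (A : Mat l m) {B B′ : Mat m n} → B ≈ᴹ B′ → A *ᴹ B ≈ᴹ A *ᴹ B′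
      *ᴹ-congˡ A = *ᴹ-cong {A = A} (λ _ _ → P.refl)

      *ᴹ-congʳ : ∀ {l m n} {A A′ : Mat l m} (B : Mat m n) → A ≈ᴹ A′ → A *ᴹ B ≈ᴹ A′ *ᴹ B
      *ᴹ-congʳ B p = *ᴹ-cong {B = B} p (λ _ _ → P.refl)

      sub-+ : ∀ w x y z → (w +ᴹ x) -ᴹ (y +ᴹ z) ≈ᴹ (w -ᴹ y) +ᴹ (x -ᴹ z)
      sub-+ w x y z = G.trans (G.∙-congˡ (G.sym (G.⁻¹-∙-comm y z))) (G.interchange w x _ _)

      inner-+ : ∀ U V a → inner (U +ᴹ V) a ≈ᴹ inner U a +ᴹ inner V a
      inner-+ U V a = G.trans
        (G.∙-cong (*ᴹ-distribʳ (Φ.act a) U V) (G.⁻¹-cong (*ᴹ-distribˡ (Ψ.act a) U V)))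
        (sub-+ _ _ _ _)

      inner-neg : ∀ U a → inner (-ᴹ U) a ≈ᴹ -ᴹ inner U a
      inner-neg U a = G.trans
        (G.∙-cong (G.sym (-ᴹ-distribˡ U (Φ.act a))) (G.⁻¹-cong (G.sym (-ᴹ-distribʳ (Ψ.act a) U))))
        (G.⁻¹-∙-comm _ _)

      inner-0 : ∀ a → inner 0ᴹ a ≈ᴹ 0ᴹ
      inner-0 a = G.trans
        (G.∙-cong (*ᴹ-zeroˡ (Φ.act a)) (G.⁻¹-cong (*ᴹ-zeroʳ (Ψ.act a)))) (G.inverseʳ 0ᴹ)

      inner-* : ∀ b U a → Ψ.act b *ᴹ inner U a ≈ᴹ inner (Ψ.act b *ᴹ U) a
      inner-* b U a = begin
        Ψ.act b *ᴹ (U *ᴹ Φ.act a -ᴹ Ψ.act a *ᴹ U)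
          ≈⟨ *ᴹ-distribˡ (Ψ.act b) _ _ ⟩
        Ψ.act b *ᴹ (U *ᴹ Φ.act a) +ᴹ Ψ.act b *ᴹ (-ᴹ (Ψ.act a *ᴹ U))
          ≈⟨ G.∙-cong (*ᴹ-assoc (Ψ.act b) U (Φ.act a)) (-ᴹ-distribʳ (Ψ.act b) (Ψ.act a *ᴹ U)) ⟨
        (Ψ.act b *ᴹ U) *ᴹ Φ.act a -ᴹ Ψ.act b *ᴹ (Ψ.act a *ᴹ U)
          ≈⟨ G.∙-congˡ (G.⁻¹-cong swap) ⟩
        (Ψ.act b *ᴹ U) *ᴹ Φ.act a -ᴹ Ψ.act a *ᴹ (Ψ.act b *ᴹ U) ∎
        where
        swap : Ψ.act b *ᴹ (Ψ.act a *ᴹ U) ≈ᴹ Ψ.act a *ᴹ (Ψ.act b *ᴹ U)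
        swap = G.trans (G.sym (*ᴹ-assoc (Ψ.act b) (Ψ.act a) U))
          (G.trans (*ᴹ-congʳ U (Ψ.act-comm b a)) (*ᴹ-assoc (Ψ.act a) (Ψ.act b) U))

      pointwise⇒∼ : ∀ {δ₁ δ₂} → (∀ a → δ δ₁ a ≈ᴹ δ δ₂ a) → δ₁ ∼ δ₂
      pointwise⇒∼ eq = mk∼ 0ᴹ λ a → G.trans (G.x≈y⇒x∙y⁻¹≈ε (eq a)) (G.sym (inner-0 a))

      telescope : ∀ x y z → (x -ᴹ y) +ᴹ (y -ᴹ z) ≈ᴹ x -ᴹ z
      telescope x y z = begin
        (x -ᴹ y) +ᴹ (y -ᴹ z)        ≈⟨ G.assoc _ _ _ ⟩
        x +ᴹ (-ᴹ y +ᴹ (y -ᴹ z))     ≈⟨ G.∙-congˡ (G.assoc (-ᴹ y) y (-ᴹ z)) ⟨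
        x +ᴹ ((-ᴹ y +ᴹ y) -ᴹ z)     ≈⟨ G.∙-congˡ (G.∙-congʳ (G.inverseˡ y)) ⟩
        x +ᴹ (0ᴹ -ᴹ z)              ≈⟨ G.∙-congˡ (G.identityˡ (-ᴹ z)) ⟩
        x -ᴹ z                      ∎

    infixl 6 _+ᴰ_
    infixr 7 _*ᴰ_
    infix  8 -ᴰ_

    _+ᴰ_ : Der → Der → Der
    δ₁ +ᴰ δ₂ = record
      { δ       = λ a → δ δ₁ a +ᴹ δ δ₂ a
      ; cong    = λ eq → G.∙-cong (cong δ₁ eq) (cong δ₂ eq)
      ; +-homo  = λ a b → G.trans (G.∙-cong (+-homo δ₁ a b) (+-homo δ₂ a b)) (G.interchange _ _ _ _)
      ; ·-homo  = λ x a → G.trans (G.∙-cong (·-homo δ₁ x a) (·-homo δ₂ x a)) (G.sym (·ᴹ-+ (κ x) _ _))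
      ; leibniz = λ a b → G.trans (G.∙-cong (leibniz δ₁ a b) (leibniz δ₂ a b))
          (G.trans (G.interchange _ _ _ _)
            (G.sym (G.∙-cong (*ᴹ-distribˡ (Ψ.act a) _ _) (*ᴹ-distribʳ (Φ.act b) _ _))))
      }

    -ᴰ_ : Der → Der
    -ᴰ δ₁ = record
      { δ       = λ a → -ᴹ δ δ₁ a
      ; cong    = λ eq → G.⁻¹-cong (cong δ₁ eq)
      ; +-homo  = λ a b → G.trans (G.⁻¹-cong (+-homo δ₁ a b)) (G.sym (G.⁻¹-∙-comm _ _))
      ; ·-homo  = λ x a → G.trans (G.⁻¹-cong (·-homo δ₁ x a)) (·ᴹ-neg (κ x) _)
      ; leibniz = λ a b → G.trans (G.⁻¹-cong (leibniz δ₁ a b))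
          (G.trans (G.sym (G.⁻¹-∙-comm _ _))
            (G.∙-cong (-ᴹ-distribʳ (Ψ.act a) _) (-ᴹ-distribˡ _ (Φ.act b))))
      }

    0ᴰ : Der
    0ᴰ = record
      { δ       = λ a → 0ᴹ
      ; cong    = λ eq → G.refl
      ; +-homo  = λ a b → G.sym (G.identityˡ _)
      ; ·-homo  = λ x a → G.sym (·ᴹ-0 (κ x))
      ; leibniz = λ a b → G.sym (G.trans (G.∙-cong (*ᴹ-zeroʳ (Ψ.act a)) (*ᴹ-zeroˡ (Φ.act b))) (G.identityˡ _))
      }

    _*ᴰ_ : A.Carrier → Der → Der
    a *ᴰ δ₁ = record
      { δ       = λ b → Ψ.act a *ᴹ δ δ₁ b
      ; cong    = λ eq → *ᴹ-congˡ (Ψ.act a) (cong δ₁ eq)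
      ; +-homo  = λ b c → G.trans (*ᴹ-congˡ (Ψ.act a) (+-homo δ₁ b c)) (*ᴹ-distribˡ (Ψ.act a) _ _)
      ; ·-homo  = λ x b → G.trans (*ᴹ-congˡ (Ψ.act a) (·-homo δ₁ x b)) (*ᴹ-·ᴹ x (Ψ.act a) _)
      ; leibniz = λ b c → begin
          Ψ.act a *ᴹ δ δ₁ (b A.* c)
            ≈⟨ *ᴹ-congˡ (Ψ.act a) (leibniz δ₁ b c) ⟩
          Ψ.act a *ᴹ (Ψ.act b *ᴹ δ δ₁ c +ᴹ δ δ₁ b *ᴹ Φ.act c)
            ≈⟨ *ᴹ-distribˡ (Ψ.act a) _ _ ⟩
          Ψ.act a *ᴹ (Ψ.act b *ᴹ δ δ₁ c) +ᴹ Ψ.act a *ᴹ (δ δ₁ b *ᴹ Φ.act c)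
            ≈⟨ G.∙-cong (*ᴹ-assoc (Ψ.act a) (Ψ.act b) _) (*ᴹ-assoc (Ψ.act a) _ (Φ.act c)) ⟨
          (Ψ.act a *ᴹ Ψ.act b) *ᴹ δ δ₁ c +ᴹ (Ψ.act a *ᴹ δ δ₁ b) *ᴹ Φ.act c
            ≈⟨ G.∙-congʳ (*ᴹ-congʳ (δ δ₁ c) (Ψ.act-comm a b)) ⟩
          (Ψ.act b *ᴹ Ψ.act a) *ᴹ δ δ₁ c +ᴹ (Ψ.act a *ᴹ δ δ₁ b) *ᴹ Φ.act c
            ≈⟨ G.∙-congʳ (*ᴹ-assoc (Ψ.act b) (Ψ.act a) _) ⟩
          Ψ.act b *ᴹ (Ψ.act a *ᴹ δ δ₁ c) +ᴹ (Ψ.act a *ᴹ δ δ₁ b) *ᴹ Φ.act c ∎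
      }

    Ext : Module A (o ⊔ c₁ ⊔ ℓ₁ ⊔ c ⊔ ℓ) (c₁ ⊔ c ⊔ ℓ)
    Ext = record { isModule = IsModuleFromLeft.isModule {commutativeRing = A} (record { isLeftModule = isLeftModule }) }
      where
      ∼-+ : ∀ {δ₁ δ₁′ δ₂ δ₂′} → δ₁ ∼ δ₁′ → δ₂ ∼ δ₂′ → (δ₁ +ᴰ δ₂) ∼ (δ₁′ +ᴰ δ₂′)
      ∼-+ (mk∼ U p) (mk∼ V q) = mk∼ (U +ᴹ V) λ a →
        G.trans (sub-+ _ _ _ _) (G.trans (G.∙-cong (p a) (q a)) (G.sym (inner-+ U V a)))

      ∼-neg : ∀ {δ₁ δ₂} → δ₁ ∼ δ₂ → (-ᴰ δ₁) ∼ (-ᴰ δ₂)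
      ∼-neg (mk∼ U p) = mk∼ (-ᴹ U) λ a →
        G.trans (G.⁻¹-∙-comm _ _) (G.trans (G.⁻¹-cong (p a)) (G.sym (inner-neg U a)))

      ∼-* : ∀ {a b δ₁ δ₂} → a A.≈ b → δ₁ ∼ δ₂ → (a *ᴰ δ₁) ∼ (b *ᴰ δ₂)
      ∼-* {a} {b} {δ₁} {δ₂} a≈b (mk∼ U p) = mk∼ (Ψ.act b *ᴹ U) λ x → begin
        Ψ.act a *ᴹ δ δ₁ x -ᴹ Ψ.act b *ᴹ δ δ₂ x
          ≈⟨ G.∙-cong (*ᴹ-congʳ (δ δ₁ x) (Ψ.act-cong a≈b)) (-ᴹ-distribʳ (Ψ.act b) (δ δ₂ x)) ⟩
        Ψ.act b *ᴹ δ δ₁ x +ᴹ Ψ.act b *ᴹ (-ᴹ δ δ₂ x)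
          ≈⟨ *ᴹ-distribˡ (Ψ.act b) _ _ ⟨
        Ψ.act b *ᴹ (δ δ₁ x -ᴹ δ δ₂ x)
          ≈⟨ *ᴹ-congˡ (Ψ.act b) (p x) ⟩
        Ψ.act b *ᴹ inner U x
          ≈⟨ inner-* b U x ⟩
        inner (Ψ.act b *ᴹ U) x ∎

      isLeftModule : IsLeftModule A.ring _∼_ _+ᴰ_ 0ᴰ -ᴰ_ _*ᴰ_
      isLeftModule = record
        { isLeftSemimodule = record
          { +ᴹ-isCommutativeMonoid = record
            { isMonoid = record
              { isSemigroup = record
                { isMagma = record
                  { isEquivalence = record
                    { refl  = pointwise⇒∼ λ a → G.refl
                    ; sym   = λ { (mk∼ U p) → mk∼ (-ᴹ U) λ a →
                        G.trans (G.sym (G.⁻¹-anti-homo-// _ _)) (G.trans (G.⁻¹-cong (p a)) (G.sym (inner-neg U a))) }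
                    ; trans = λ { (mk∼ U p) (mk∼ V q) → mk∼ (U +ᴹ V) λ a →
                        G.trans (G.sym (telescope _ _ _)) (G.trans (G.∙-cong (p a) (q a)) (G.sym (inner-+ U V a))) }
                    }
                  ; ∙-cong = ∼-+
                  }
                ; assoc = λ δ₁ δ₂ δ₃ → pointwise⇒∼ λ a → G.assoc _ _ _
                }
              ; identity = (λ δ₁ → pointwise⇒∼ λ a → G.identityˡ _)
                         , (λ δ₁ → pointwise⇒∼ λ a → G.identityʳ _)
              }
            ; comm = λ δ₁ δ₂ → pointwise⇒∼ λ a → G.comm _ _
            }
          ; isPreleftSemimodule = record
            { *ₗ-cong      = ∼-*
            ; *ₗ-zeroˡ     = λ δ₁ → pointwise⇒∼ λ a →
                G.trans (*ᴹ-congʳ (δ δ₁ a) Ψ.act-0) (*ᴹ-zeroˡ (δ δ₁ a))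
            ; *ₗ-distribʳ  = λ δ₁ a b → pointwise⇒∼ λ x →
                G.trans (*ᴹ-congʳ (δ δ₁ x) (Ψ.act-+ a b)) (*ᴹ-distribʳ (δ δ₁ x) _ _)
            ; *ₗ-identityˡ = λ δ₁ → pointwise⇒∼ λ a →
                G.trans (*ᴹ-congʳ (δ δ₁ a) Ψ.act-1)
                  λ i j → P.trans (scalar-*ᴹ P.1# (δ δ₁ a) i j) (P.*-identityˡ _)
            ; *ₗ-assoc     = λ a b δ₁ → pointwise⇒∼ λ x →
                G.trans (*ᴹ-congʳ (δ δ₁ x) (Ψ.act-* a b)) (*ᴹ-assoc (Ψ.act a) (Ψ.act b) (δ δ₁ x))
            ; *ₗ-zeroʳ     = λ a → pointwise⇒∼ λ x → *ᴹ-zeroʳ (Ψ.act a)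
            ; *ₗ-distribˡ  = λ a δ₁ δ₂ → pointwise⇒∼ λ x → *ᴹ-distribˡ (Ψ.act a) _ _
            }
          }
        ; -ᴹ‿cong    = ∼-neg
        ; -ᴹ‿inverse = (λ δ₁ → pointwise⇒∼ λ a → G.inverseˡ _)
                     , (λ δ₁ → pointwise⇒∼ λ a → G.inverseʳ _)
        }

module _ {F : FiniteField c₁ ℓ₁ ℓ₂} {ℓ′ : Level} {K : AField F c ℓ ℓ′} (T : Twist K) where
  private
    module F    = FiniteField F
    module K    = AField K
    module T    = Twist T
    module A    = CommutativeRing (Fq[t] F)
    module F[t] = Polynomial F.commutativeRing
    module KM   = Matrix K.ring

  module K[T] = SkewPolynomial K.ring T.endomorphism

  open Matrix K[T].ring

  private
    module P = Ring K[T].ring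

  -- the structure map of the F-algebra K{T}
  κ : F.Carrier → K[T].Poly
  κ x = K[T].constant (K.η x)

  κ-central : ∀ x f → κ x P.* f P.≈ f P.* κ x
  κ-central x f = K[T].mk≈ₚ λ n → begin
    K[T].coeff (κ x P.* f) n                 ≈⟨ K[T].constant-*ˡ (K.η x) f n ⟩
    K.η x K.* K[T].coeff f n                 ≈⟨ K.*-comm _ _ ⟩
    K[T].coeff f n K.* K.η x                 ≈⟨ K.*-congˡ (fixes n) ⟨
    K[T].coeff f n K.* T.apply^ n (K.η x)    ≈⟨ K[T].constant-*ʳ f (K.η x) n ⟨
    K[T].coeff (f P.* κ x) n                 ∎
    where
    open SetoidReasoning K.setoid
    fixes : ∀ n → T.apply^ n (K.η x) K.≈ K.η x
    fixes zero    = K.refl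
    fixes (suc n) = K.trans (T.apply^-cong n (T.fixes-F x)) (fixes n)

  -- A ↦ A₀ for A = Σᵢ Aᵢ Tⁱ
  ∂ : ∀ {m n} → Mat m n → KM.Mat m n
  ∂ A i j = K[T].coeff (A i j) 0

  open Biderivation (Fq[t] F) K[T].ring F[t].constant κ κ-central public
    using (Representation; Der; inner; _∼_)
    renaming (Ext to Ext′)

  -- With act t = Σᵢ Mᵢ Tⁱ, the nilpotency condition says M₀ = θI + N with N nilpotent.
  record TModule (d : ℕ) : Set (c₁ ⊔ ℓ₁ ⊔ c ⊔ ℓ) where
    open Exp (Ring.semiring (KM.matrixRing d)) using (_^_)
    field
      representation : Representation d

    open Representation representation public

    field
      nilpotent : ∃ λ k → (∂ (act F[t].variable-X) KM.-ᴹ KM.scalar K.θ) ^ k KM.≈ᴹ KM.0ᴹ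

  Ext : ∀ {d e} → TModule d → TModule e → Module (Fq[t] F) (c₁ ⊔ ℓ₁ ⊔ c ⊔ ℓ) (c₁ ⊔ ℓ₁ ⊔ c ⊔ ℓ)
  Ext Φ Ψ = Ext′ (TModule.representation Φ) (TModule.representation Ψ)

module _ {F : FiniteField c₁ ℓ₁ ℓ₂} {ℓ′ : Level} (K : AField F c ℓ ℓ′) (perfect : IsPerfect K) where
  private
    module F    = FiniteField F
    module K    = AField K
    module A    = CommutativeRing (Fq[t] F)
    module F[t] = Polynomial F.commutativeRing
    module KM   = Matrix K.ring
    τK = τ K
    σK = σ K perfect
    module K[τ] = Ring (K[T].ring τK)
    module K[σ] = Ring (K[T].ring σK)
    module Mτ = Matrix (K[T].ring τK)
    module Mσ = Matrix (K[T].ring σK)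

    module Kᵀ = TransposeMap K.ring K.ring id

  -- Σ aᵢ τⁱ ↦ Σ aᵢ^(1/qⁱ) σⁱ
  open Star K.commutativeRing (Twist.endomorphism τK) (Twist.endomorphism σK) public
    using () renaming (star to infix 9 _ˢ; star-cong to ˢ-cong; star-+ to ˢ-+; star-constant to ˢ-constant)

  ˢ-* : ∀ f g → (f K[τ].* g) ˢ K[σ].≈ g ˢ K[σ].* f ˢ
  ˢ-* = Star.star-* K.commutativeRing (Twist.endomorphism τK) (Twist.endomorphism σK) (^q-root K perfect)

  -- the transpose of the matrix obtained by applying (-)ˢ entrywise
  _ˢᵀ : ∀ {m n} → Mτ.Mat m n → Mσ.Mat n m
  _ˢᵀ = TransposeMap.transposeMap (K[T].ring τK) (K[T].ring σK) _ˢ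

  ˢᵀ-* : ∀ {l m n} (A : Mτ.Mat l m) (B : Mτ.Mat m n) → (A Mτ.*ᴹ B) ˢᵀ Mσ.≈ᴹ B ˢᵀ Mσ.*ᴹ A ˢᵀ
  ˢᵀ-* = TransposeMap.transposeMap-* (K[T].ring τK) (K[T].ring σK) _ˢ
    ˢ-cong (ˢ-constant K.0#) ˢ-+ ˢ-*

  ˢᵀ-scalar : ∀ {n} x → Mτ.scalar {n} (κ τK x) ˢᵀ Mσ.≈ᴹ Mσ.scalar (κ σK x)
  ˢᵀ-scalar x = TransposeMap.transposeMap-scalar (K[T].ring τK) (K[T].ring σK) _ˢ
    ˢ-cong (ˢ-constant K.0#) ˢ-+ ˢ-* (ˢ-constant (K.η x))

  dual : ∀ {d} → TModule τK d → TModule σK d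
  dual {d} Φ = record
    { representation = record
      { act       = λ a → Φ.act a ˢᵀ
      ; isRingHom = mkIsRingHom A.ring (Mσ.matrixRing d) (λ a → Φ.act a ˢᵀ)
          (λ eq i j → ˢ-cong (Φ.act-cong eq j i))
          (λ a b i j → K[σ].trans (ˢ-cong (Φ.act-+ a b j i)) (ˢ-+ (Φ.act a j i) (Φ.act b j i)))
          (λ a b → S.trans {i = Φ.act (a A.* b) ˢᵀ} {j = Φ.act (b A.* a) ˢᵀ}
            (λ i j → ˢ-cong (Φ.act-cong (A.*-comm a b) j i))
            (S.trans {j = (Φ.act b Mτ.*ᴹ Φ.act a) ˢᵀ}
              (λ i j → ˢ-cong (Φ.act-* b a j i)) (ˢᵀ-* (Φ.act b) (Φ.act a))))
          (S.trans {j = Mτ.scalar K[τ].1# ˢᵀ} (λ i j → ˢ-cong (Φ.act-1 j i))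
            (TransposeMap.transposeMap-scalar (K[T].ring τK) (K[T].ring σK) _ˢ
              ˢ-cong (ˢ-constant K.0#) ˢ-+ ˢ-* (ˢ-constant K.1#)))
      ; act-κ     = λ x → S.trans {j = Mτ.scalar (κ τK x) ˢᵀ}
          (λ i j → ˢ-cong (Φ.act-κ x j i)) (ˢᵀ-scalar x)
      }
    ; nilpotent = proj₁ Φ.nilpotent , nilpotentᵀ (proj₁ Φ.nilpotent) (proj₂ Φ.nilpotent)
    }
    where
    module Φ = TModule Φ
    module S = Ring (Mσ.matrixRing d)
    module KMR = Ring (KM.matrixRing d)
    open Exp KMR.semiring using (_^_; ^-congˡ; ^-homo-*)

    N N′ : KM.Mat d d
    N  = ∂ τK (Φ.act F[t].variable-X) KM.-ᴹ KM.scalar K.θ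
    N′ = ∂ σK (Φ.act F[t].variable-X ˢᵀ) KM.-ᴹ KM.scalar K.θ

    scalarᵀ : ∀ {n} x → Kᵀ.transposeMap (KM.scalar {n} x) KM.≈ᴹ KM.scalar x
    scalarᵀ x = Kᵀ.transposeMap-scalar id K.refl (λ _ _ → K.refl) K.*-comm K.refl

    N′≈Nᵀ : N′ KM.≈ᴹ Kᵀ.transposeMap N
    N′≈Nᵀ i j = K.+-congˡ (K.-‿cong (K.sym (scalarᵀ K.θ i j)))

    ^-suc′ : ∀ (A : KM.Mat d d) n → A ^ n KM.*ᴹ A KM.≈ᴹ A ^ suc n
    ^-suc′ A n = KMR.trans
      (KM.*ᴹ-cong {A = A ^ n} (λ _ _ → K.refl) (KMR.sym (KMR.*-identityʳ A)))
      (KMR.trans (KMR.sym (^-homo-* A n 1)) (KMR.reflexive (≡.cong (A ^_) (ℕₚ.+-comm n 1))))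

    ^ᵀ : ∀ (A : KM.Mat d d) n → Kᵀ.transposeMap A ^ n KM.≈ᴹ Kᵀ.transposeMap (A ^ n)
    ^ᵀ A zero    = KMR.sym (scalarᵀ K.1#)
    ^ᵀ A (suc n) = KMR.trans
      (KM.*ᴹ-cong {A = Kᵀ.transposeMap A} (λ _ _ → K.refl) (^ᵀ A n))
      (KMR.trans (KMR.sym (Kᵀ.transposeMap-* id K.refl (λ _ _ → K.refl) K.*-comm (A ^ n) A))
        (λ i j → ^-suc′ A n j i))

    nilpotentᵀ : ∀ k → N ^ k KM.≈ᴹ KM.0ᴹ → N′ ^ k KM.≈ᴹ KM.0ᴹ
    nilpotentᵀ k Nᵏ≈0 = KMR.trans (^-congˡ k N′≈Nᵀ) (KMR.trans (^ᵀ N k) λ i j → Nᵏ≈0 j i)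

infix 9 _^σ[_]
_^σ[_] : ∀ {F : FiniteField c₁ ℓ₁ ℓ₂} {ℓ′} {K : AField F c ℓ ℓ′} {d} →
         TModule (τ K) d → (perfect : IsPerfect K) → TModule (σ K perfect) d
_^σ[_] {K = K} Φ perfect = dual K perfect Φ

infix 4 _≅_
_≅_ : {R : CommutativeRing c ℓ} → Module R c₁ ℓ₁ → Module R c₂ ℓ₂ → Set (c ⊔ c₁ ⊔ c₂ ⊔ ℓ₁ ⊔ ℓ₂)
M ≅ N = ∃ (IsModuleIsomorphism (Module.rawModule M) (Module.rawModule N))

{-# OPTIONS --safe #-}

-- Applying (-)^σ entrywise and transposing reverses products, so it turns a biderivation δ of (Φ, Ψ)
-- into a biderivation of (Ψ^σ, Φ^σ) and δ^(U) into minus the inner biderivation of the image of U;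
-- over a perfect field it is bijective. It intertwines the left action a ∗ δ = Ψ_a δ with the right
-- action δ ↦ δ Φ_a, and these agree on Ext¹: commutativity of 𝔽_q[t] gives δ(ab) = δ(ba), hence
-- δ(b) Φ_a − Ψ_a δ(b) = δ(a) Φ_b − Ψ_b δ(a), which is the inner biderivation of the matrix δ(a).

module Submission where

open import Defs
open import Algebra.Bundles using (Ring; CommutativeRing; AbelianGroup)
open import Algebra.Module.Bundles using (Module)
open import Algebra.Morphism.Structures using (IsRingHomomorphism)
open import Data.Nat.Base using (ℕ; zero; suc)
open import Data.Product.Base using (_,_)
open import Level using (Level)

import Algebra.Construct.Flip.Op as Op
import Algebra.Properties.AbelianGroup as AbelianGroupProperties
import Relation.Binary.PropositionalEquality as ≡
import Relation.Binary.Reasoning.Setoid as SetoidReasoning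

private
  variable
    o c c₁ c₂ ℓ ℓ₁ ℓ₂ : Level

-- Rearrangement in abelian groups

module AbelianGroupLemmas (G : AbelianGroup c ℓ) where
  open AbelianGroup G
  open AbelianGroupProperties G
  open SetoidReasoning setoid

  -- Shaped for comparing the Leibniz expansions of δ(ab) and δ(ba): terms are paired crosswise, so
  -- that each side of the result involves only one of δ(a), δ(b).
  ∙-swap-// : ∀ {w x y z} → x ∙ y ≈ z ∙ w → w - x ≈ y - z
  ∙-swap-// {w} {x} {y} {z} eq = begin
    w - x                 ≈⟨ ∙-congʳ (\\-leftDividesʳ z w) ⟨
    (z ⁻¹ ∙ (z ∙ w)) - x  ≈⟨ ∙-congʳ (∙-congˡ eq) ⟨
    (z ⁻¹ ∙ (x ∙ y)) - x  ≈⟨ ∙-congʳ (∙-congˡ (comm x y)) ⟩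
    (z ⁻¹ ∙ (y ∙ x)) - x  ≈⟨ ∙-congʳ (assoc (z ⁻¹) y x) ⟨
    ((z ⁻¹ ∙ y) ∙ x) - x  ≈⟨ //-rightDividesʳ x (z ⁻¹ ∙ y) ⟩
    z ⁻¹ ∙ y              ≈⟨ comm (z ⁻¹) y ⟩
    y - z                 ∎

-- Left and right scalar actions on biderivations

module BiderivationLemmas {S : Set o} (A : CommutativeRing c₁ ℓ₁) (P : Ring c ℓ)
    (κA : S → CommutativeRing.Carrier A) (κ : S → Ring.Carrier P)
    (κ-central : ∀ x f → Ring._≈_ P (Ring._*_ P (κ x) f) (Ring._*_ P f (κ x)))
    where
  open Matrix P
  private
    module B = Biderivation A P κA κ κ-central
    module A = CommutativeRing A

  module _ {d e : ℕ} (Φ : B.Representation d) (Ψ : B.Representation e) where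
    private
      module Φ = B.Representation Φ
      module Ψ = B.Representation Ψ
      module G where
        open AbelianGroup (abelianGroup e d) public
        open AbelianGroupProperties (abelianGroup e d) public
        open AbelianGroupLemmas (abelianGroup e d) public
    open B.Der

    -- The zero matrix is the witness. This suffices for laws that hold already in `Der`: additivity
    -- of the transposition below and both of its inverse laws.
    pointwise⇒∼ : ∀ {δ₁ δ₂} → (∀ a → δ δ₁ a ≈ᴹ δ δ₂ a) → B._∼_ Φ Ψ δ₁ δ₂
    pointwise⇒∼ eq = B.mk∼ 0ᴹ λ a → G.trans (G.x≈y⇒x∙y⁻¹≈ε (eq a))
      (G.sym (G.x≈y⇒x∙y⁻¹≈ε (G.trans (*ᴹ-zeroˡ (Φ.act a)) (G.sym (*ᴹ-zeroʳ (Ψ.act a))))))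

    right-left-inner : ∀ (δ₁ : B.Der Φ Ψ) a b →
      δ δ₁ b *ᴹ Φ.act a -ᴹ Ψ.act a *ᴹ δ δ₁ b ≈ᴹ B.inner Φ Ψ (δ δ₁ a) b
    right-left-inner δ₁ a b = G.∙-swap-// (G.trans (G.sym (leibniz δ₁ a b))
      (G.trans (cong δ₁ (A.*-comm a b)) (leibniz δ₁ b a)))

-- Transport of biderivations along an anti-homomorphism

module TransposeBiderivation {S : Set o} (A : CommutativeRing c₁ ℓ₁) (P : Ring c ℓ) (Q : Ring c₂ ℓ₂)
    (κA : S → CommutativeRing.Carrier A) (κP : S → Ring.Carrier P) (κQ : S → Ring.Carrier Q)
    (κP-central : ∀ x f → Ring._≈_ P (Ring._*_ P (κP x) f) (Ring._*_ P f (κP x)))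
    (κQ-central : ∀ x f → Ring._≈_ Q (Ring._*_ Q (κQ x) f) (Ring._*_ Q f (κQ x)))
    {f : Ring.Carrier P → Ring.Carrier Q}
    (f-isAntiHom : IsRingHom P (Op.ring Q) f)
    (f-κ : ∀ x → Ring._≈_ Q (f (κP x)) (κQ x))
    where
  private
    module A = CommutativeRing A
    module P = Ring P
    module Q = Ring Q
    module f = IsRingHomomorphism f-isAntiHom
    module MP = Matrix P
    module MQ = Matrix Q
    module BP = Biderivation A P κA κP κP-central
    module BQ = Biderivation A Q κA κQ κQ-central
    module BQₚ = BiderivationLemmas A Q κA κQ κQ-central

  infix 9 _ᵀ
  _ᵀ : ∀ {m n} → MP.Mat m n → MQ.Mat n m
  _ᵀ = TransposeMap.transposeMap P Q f

  ᵀ-cong : ∀ {m n} {M N : MP.Mat m n} → M MP.≈ᴹ N → M ᵀ MQ.≈ᴹ N ᵀ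
  ᵀ-cong eq i j = f.⟦⟧-cong (eq j i)

  -- Over noncommutative entries transposition alone does not reverse products; the missing swap
  -- inside each summand comes from `f.*-homo`, whose target is the opposite ring.
  ᵀ-* : ∀ {l m n} (M : MP.Mat l m) (N : MP.Mat m n) → (M MP.*ᴹ N) ᵀ MQ.≈ᴹ N ᵀ MQ.*ᴹ M ᵀ
  ᵀ-* = TransposeMap.transposeMap-* P Q f f.⟦⟧-cong f.0#-homo f.+-homo f.*-homo

  ᵀ-- : ∀ {m n} (M N : MP.Mat m n) → (M MP.-ᴹ N) ᵀ MQ.≈ᴹ M ᵀ MQ.-ᴹ N ᵀ
  ᵀ-- M N i j = Q.trans (f.+-homo _ _) (Q.+-congˡ (f.-‿homo _))

  -- The duals are given as data compared up to `≈ᴹ` rather than computed, so that the same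
  -- construction can be run backwards from `Ψ*`, `Φ*` to `Φ`, `Ψ`.
  module _ {d e : ℕ} (Φ : BP.Representation d) (Ψ : BP.Representation e)
           (Φ* : BQ.Representation d) (Ψ* : BQ.Representation e)
           (Φ-dual : ∀ a → BP.Representation.act Φ a ᵀ MQ.≈ᴹ BQ.Representation.act Φ* a)
           (Ψ-dual : ∀ a → BP.Representation.act Ψ a ᵀ MQ.≈ᴹ BQ.Representation.act Ψ* a)
           where
    private
      module Φ = BP.Representation Φ
      module Ψ = BP.Representation Ψ
      module Φ* = BQ.Representation Φ*
      module Ψ* = BQ.Representation Ψ*
      module GP where
        open AbelianGroup (MP.abelianGroup e d) public
        open AbelianGroupProperties (MP.abelianGroup e d) public
      module GQ = AbelianGroup (MQ.abelianGroup d e)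
      module ExtP = Module (BP.Ext Φ Ψ)
      module ExtQ = Module (BQ.Ext Ψ* Φ*)
      open BP.Der
      open SetoidReasoning GQ.setoid

    ᵀ-Φ : ∀ (U : MP.Mat e d) a → (U MP.*ᴹ Φ.act a) ᵀ MQ.≈ᴹ Φ*.act a MQ.*ᴹ U ᵀ
    ᵀ-Φ U a = GQ.trans (ᵀ-* U (Φ.act a)) (MQ.*ᴹ-cong {B = U ᵀ} (Φ-dual a) (λ _ _ → Q.refl))

    ᵀ-Ψ : ∀ (U : MP.Mat e d) a → (Ψ.act a MP.*ᴹ U) ᵀ MQ.≈ᴹ U ᵀ MQ.*ᴹ Ψ*.act a
    ᵀ-Ψ U a = GQ.trans (ᵀ-* (Ψ.act a) U) (MQ.*ᴹ-cong {A = U ᵀ} (λ _ _ → Q.refl) (Ψ-dual a))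

    transposeDer : BP.Der Φ Ψ → BQ.Der Ψ* Φ*
    transposeDer δ₁ = record
      { δ       = λ a → δ δ₁ a ᵀ
      ; cong    = λ eq → ᵀ-cong (cong δ₁ eq)
      ; +-homo  = λ a b i j → Q.trans (f.⟦⟧-cong (+-homo δ₁ a b j i)) (f.+-homo _ _)
      -- Reversal puts the scalar on the right; centrality of `κQ x` brings it back.
      ; ·-homo  = λ x a i j → Q.trans (f.⟦⟧-cong (·-homo δ₁ x a j i))
          (Q.trans (f.*-homo _ _) (Q.trans (Q.*-congˡ (f-κ x)) (Q.sym (κQ-central x _))))
      ; leibniz = λ a b → begin
          δ δ₁ (a A.* b) ᵀ
            -- Transposition of the expansion of δ(ba), not of δ(ab), has `a` and `b` in the places
            -- that the new Leibniz rule demands.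
            ≈⟨ ᵀ-cong (cong δ₁ (A.*-comm a b)) ⟩
          δ δ₁ (b A.* a) ᵀ
            ≈⟨ ᵀ-cong (leibniz δ₁ b a) ⟩
          (Ψ.act b MP.*ᴹ δ δ₁ a MP.+ᴹ δ δ₁ b MP.*ᴹ Φ.act a) ᵀ
            ≈⟨ (λ i j → f.+-homo _ _) ⟩
          (Ψ.act b MP.*ᴹ δ δ₁ a) ᵀ MQ.+ᴹ (δ δ₁ b MP.*ᴹ Φ.act a) ᵀ
            ≈⟨ GQ.∙-cong (ᵀ-Ψ (δ δ₁ a) b) (ᵀ-Φ (δ δ₁ b) a) ⟩
          δ δ₁ a ᵀ MQ.*ᴹ Ψ*.act b MQ.+ᴹ Φ*.act a MQ.*ᴹ δ δ₁ b ᵀ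
            ≈⟨ GQ.comm _ _ ⟩
          Φ*.act a MQ.*ᴹ δ δ₁ b ᵀ MQ.+ᴹ δ δ₁ a ᵀ MQ.*ᴹ Ψ*.act b ∎
      }

    transposeDer-cong : ∀ {δ₁ δ₂} → δ₁ ExtP.≈ᴹ δ₂ → transposeDer δ₁ ExtQ.≈ᴹ transposeDer δ₂
    -- The minus sign in front of the inner biderivation of `U ᵀ` is absorbed by comparing in the
    -- opposite order, hence the symmetry.
    transposeDer-cong {δ₁} {δ₂} (BP.mk∼ U p) = ExtQ.≈ᴹ-sym (BQ.mk∼ (U ᵀ) λ a → begin
      δ δ₂ a ᵀ MQ.-ᴹ δ δ₁ a ᵀ
        ≈⟨ ᵀ-- (δ δ₂ a) (δ δ₁ a) ⟨
      (δ δ₂ a MP.-ᴹ δ δ₁ a) ᵀ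
        ≈⟨ ᵀ-cong (GP.trans (GP.sym (GP.⁻¹-anti-homo‿- (δ δ₁ a) (δ δ₂ a)))
             (GP.trans (GP.⁻¹-cong (p a)) (GP.⁻¹-anti-homo‿- (U MP.*ᴹ Φ.act a) (Ψ.act a MP.*ᴹ U)))) ⟩
      (Ψ.act a MP.*ᴹ U MP.-ᴹ U MP.*ᴹ Φ.act a) ᵀ
        ≈⟨ ᵀ-- (Ψ.act a MP.*ᴹ U) (U MP.*ᴹ Φ.act a) ⟩
      (Ψ.act a MP.*ᴹ U) ᵀ MQ.-ᴹ (U MP.*ᴹ Φ.act a) ᵀ
        ≈⟨ GQ.∙-cong (ᵀ-Ψ U a) (GQ.⁻¹-cong (ᵀ-Φ U a)) ⟩
      BQ.inner Ψ* Φ* (U ᵀ) a ∎)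

    transposeDer-+ : ∀ δ₁ δ₂ →
      transposeDer (δ₁ ExtP.+ᴹ δ₂) ExtQ.≈ᴹ transposeDer δ₁ ExtQ.+ᴹ transposeDer δ₂
    transposeDer-+ δ₁ δ₂ = BQₚ.pointwise⇒∼ Ψ* Φ* λ a i j → f.+-homo _ _

    transposeDer-0 : transposeDer ExtP.0ᴹ ExtQ.≈ᴹ ExtQ.0ᴹ
    transposeDer-0 = BQₚ.pointwise⇒∼ Ψ* Φ* λ a i j → f.0#-homo

    transposeDer-neg : ∀ δ₁ → transposeDer (ExtP.-ᴹ δ₁) ExtQ.≈ᴹ ExtQ.-ᴹ transposeDer δ₁
    transposeDer-neg δ₁ = BQₚ.pointwise⇒∼ Ψ* Φ* λ a i j → f.-‿homo _

    transposeDer-* : ∀ a δ₁ → transposeDer (a ExtP.*ₗ δ₁) ExtQ.≈ᴹ a ExtQ.*ₗ transposeDer δ₁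
    -- After `ᵀ-Ψ` the left side is the right action of `a` on the transposed biderivation; it
    -- differs from the left action by the inner biderivation of that biderivation's value at `a`.
    transposeDer-* a δ₁ = BQ.mk∼ (δ δ₁ a ᵀ) λ b → GQ.trans
      (GQ.∙-congʳ (ᵀ-Ψ (δ δ₁ b) a))
      (BQₚ.right-left-inner Ψ* Φ* (transposeDer δ₁) a b)

-- The isomorphism of Ext modules induced by an anti-isomorphism

module AntiIsomorphism {S : Set o} (A : CommutativeRing c₁ ℓ₁) (P : Ring c ℓ) (Q : Ring c₂ ℓ₂)
    (κA : S → CommutativeRing.Carrier A) (κP : S → Ring.Carrier P) (κQ : S → Ring.Carrier Q)
    (κP-central : ∀ x f → Ring._≈_ P (Ring._*_ P (κP x) f) (Ring._*_ P f (κP x)))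
    (κQ-central : ∀ x f → Ring._≈_ Q (Ring._*_ Q (κQ x) f) (Ring._*_ Q f (κQ x)))
    {f : Ring.Carrier P → Ring.Carrier Q} {g : Ring.Carrier Q → Ring.Carrier P}
    (f-isAntiHom : IsRingHom P (Op.ring Q) f) (g-isAntiHom : IsRingHom Q (Op.ring P) g)
    (gf : ∀ x → Ring._≈_ P (g (f x)) x) (fg : ∀ y → Ring._≈_ Q (f (g y)) y)
    (f-κ : ∀ x → Ring._≈_ Q (f (κP x)) (κQ x))
    where
  private
    module P = Ring P
    module Q = Ring Q
    module g = IsRingHomomorphism g-isAntiHom
    module MQ = Matrix Q
    module BP = Biderivation A P κA κP κP-central
    module BQ = Biderivation A Q κA κQ κQ-central
    module T   = TransposeBiderivation A P Q κA κP κQ κP-central κQ-central f-isAntiHom f-κ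
    module T⁻¹ = TransposeBiderivation A Q P κA κQ κP κQ-central κP-central g-isAntiHom
      (λ x → P.trans (g.⟦⟧-cong (Q.sym (f-κ x))) (gf (κP x)))

  module _ {d e : ℕ} (Φ : BP.Representation d) (Ψ : BP.Representation e)
           (Φ* : BQ.Representation d) (Ψ* : BQ.Representation e)
           (Φ-dual : ∀ a → BP.Representation.act Φ a T.ᵀ MQ.≈ᴹ BQ.Representation.act Φ* a)
           (Ψ-dual : ∀ a → BP.Representation.act Ψ a T.ᵀ MQ.≈ᴹ BQ.Representation.act Ψ* a)
           where
    private
      module ExtP = Module (BP.Ext Φ Ψ)
      module ExtQ = Module (BQ.Ext Ψ* Φ*)

      untransposeDer : BQ.Der Ψ* Φ* → BP.Der Φ Ψ
      untransposeDer = T⁻¹.transposeDer Ψ* Φ* Ψ Φ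
        -- Two transpositions restore the indices and leave `g (f _)` in each entry.
        (λ a i j → P.trans (g.⟦⟧-cong (Q.sym (Ψ-dual a j i))) (gf _))
        (λ a i j → P.trans (g.⟦⟧-cong (Q.sym (Φ-dual a j i))) (gf _))

      untransposeDer-cong : ∀ {δ₁ δ₂} → δ₁ ExtQ.≈ᴹ δ₂ → untransposeDer δ₁ ExtP.≈ᴹ untransposeDer δ₂
      untransposeDer-cong = T⁻¹.transposeDer-cong Ψ* Φ* Ψ Φ _ _

      transposeDer = T.transposeDer Φ Ψ Φ* Ψ* Φ-dual Ψ-dual

      transposeDer-cong : ∀ {δ₁ δ₂} → δ₁ ExtP.≈ᴹ δ₂ → transposeDer δ₁ ExtQ.≈ᴹ transposeDer δ₂
      transposeDer-cong = T.transposeDer-cong Φ Ψ Φ* Ψ* Φ-dual Ψ-dual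

      inverseˡ : ∀ δ₁ → untransposeDer (transposeDer δ₁) ExtP.≈ᴹ δ₁
      inverseˡ δ₁ = BiderivationLemmas.pointwise⇒∼ A P κA κP κP-central Φ Ψ λ a i j → gf _

      inverseʳ : ∀ δ₁ → transposeDer (untransposeDer δ₁) ExtQ.≈ᴹ δ₁
      inverseʳ δ₁ = BiderivationLemmas.pointwise⇒∼ A Q κA κQ κQ-central Ψ* Φ* λ a i j → fg _

    Ext-≅ : BP.Ext Φ Ψ ≅ BQ.Ext Ψ* Φ*
    Ext-≅ = transposeDer , record
      { isModuleMonomorphism = record
        { isModuleHomomorphism = record
          { isBimoduleHomomorphism = record
            { +ᴹ-isGroupHomomorphism = record
              { isMonoidHomomorphism = record
                { isMagmaHomomorphism = record
                  { isRelHomomorphism = record { cong = transposeDer-cong }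
                  ; homo              = T.transposeDer-+ Φ Ψ Φ* Ψ* Φ-dual Ψ-dual
                  }
                ; ε-homo = T.transposeDer-0 Φ Ψ Φ* Ψ* Φ-dual Ψ-dual
                }
              ; ⁻¹-homo = T.transposeDer-neg Φ Ψ Φ* Ψ* Φ-dual Ψ-dual
              }
            ; *ₗ-homo = T.transposeDer-* Φ Ψ Φ* Ψ* Φ-dual Ψ-dual
            -- The right action on `Ext` is the flipped left action by construction.
            ; *ᵣ-homo = T.transposeDer-* Φ Ψ Φ* Ψ* Φ-dual Ψ-dual
            }
          }
        ; injective = λ {δ₁} {δ₂} eq → ExtP.≈ᴹ-trans (ExtP.≈ᴹ-sym (inverseˡ δ₁))
            (ExtP.≈ᴹ-trans (untransposeDer-cong eq) (inverseˡ δ₂))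
        }
      ; surjective = λ δ₁ → untransposeDer δ₁ , λ eq →
          ExtQ.≈ᴹ-trans (transposeDer-cong eq) (inverseʳ δ₁)
      }

-- The star map as an anti-isomorphism of skew polynomial rings

module StarLemmas (R : CommutativeRing c ℓ) (φ ψ : Endomorphism (CommutativeRing.ring R)) where
  open CommutativeRing R using (_≈_; ring; refl; setoid)
  open SetoidReasoning setoid
  private
    module φ = Endomorphism φ
    module ψ = Endomorphism ψ
    module X = SkewPolynomial ring φ
    module Y = SkewPolynomial ring ψ

  star : X.Poly → Y.Poly
  star = Star.star R φ ψ

  module _ (ψφ : ∀ x → ψ.apply (φ.apply x) ≈ x) where

    apply^-inverse : ∀ n x → ψ.apply^ n (φ.apply^ n x) ≈ x
    apply^-inverse zero    x = refl
    apply^-inverse (suc n) x = begin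
      -- Iteration adds its new factor innermost; moving that φ outside the other n puts it next to
      -- ψ.
      ψ.apply^ n (ψ.apply (φ.apply^ n (φ.apply x)))  ≡⟨ ≡.cong (λ y → ψ.apply^ n (ψ.apply y)) (φ.apply^-suc n x) ⟩
      ψ.apply^ n (ψ.apply (φ.apply (φ.apply^ n x)))  ≈⟨ ψ.apply^-cong n (ψφ _) ⟩
      ψ.apply^ n (φ.apply^ n x)                      ≈⟨ apply^-inverse n x ⟩
      x                                              ∎

    -- In degree n the inner star applies φⁿ and the outer one ψⁿ. The opposite composite needs φψ =
    -- id, which is this lemma with φ and ψ exchanged.
    star-inverse : ∀ h → star (Star.star R ψ φ h) Y.≈ₚ h
    star-inverse h = Y.mk≈ₚ λ n → apply^-inverse n (Y.coeff h n)

    star-isAntiHom : IsRingHom X.ring (Op.ring Y.ring) star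
    star-isAntiHom = mkIsRingHom X.ring (Op.ring Y.ring) star
      (Star.star-cong R φ ψ) (Star.star-+ R φ ψ) (Star.star-* R φ ψ ψφ) (Star.star-constant R φ ψ _)

theorem7p3 : ∀ {c₁ ℓ₁ ℓ₂ c ℓ ℓ′ : Level} (F : FiniteField c₁ ℓ₁ ℓ₂) (K : AField F c ℓ ℓ′)
    (perfect : IsPerfect K) {d e : ℕ} (Φ : TModule (τ K) d) (Ψ : TModule (τ K) e) →
    Ext (τ K) Φ Ψ ≅ Ext (σ K perfect) (Ψ ^σ[ perfect ]) (Φ ^σ[ perfect ])
theorem7p3 F K perfect Φ Ψ = AntiIsomorphism.Ext-≅
  (Fq[t] F) K[τ].ring K[σ].ring F[t].constant (κ (τ K)) (κ (σ K perfect))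
  (κ-central (τ K)) (κ-central (σ K perfect))
  -- Over a perfect field root and q-th power are inverse on both sides; each identity gives one
  -- anti-homomorphism and one inverse law.
  (τσ.star-isAntiHom (^q-root K perfect)) (στ.star-isAntiHom (root-^q K perfect))
  (στ.star-inverse (root-^q K perfect)) (τσ.star-inverse (^q-root K perfect))
  (λ x → ˢ-constant K perfect (K.η x))
  Φ.representation Ψ.representation Φ^σ.representation Ψ^σ.representation
  -- The dual acts by `act a ˢᵀ` by definition.
  (λ a i j → K[σ].refl) (λ a i j → K[σ].refl)
  where
  module K    = AField K
  module Φ    = TModule Φ
  module Ψ    = TModule Ψ
  module Φ^σ  = TModule (Φ ^σ[ perfect ])
  module Ψ^σ  = TModule (Ψ ^σ[ perfect ])
  module F[t] = Polynomial (FiniteField.commutativeRing F)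
  module K[τ] = K[T] (τ K)
  module K[σ] where
    open K[T] (σ K perfect) public
    open Ring ring public using (refl)
  module τσ = StarLemmas K.commutativeRing (Twist.endomorphism (τ K)) (Twist.endomorphism (σ K perfect))
  module στ = StarLemmas K.commutativeRing (Twist.endomorphism (σ K perfect)) (Twist.endomorphism (τ K))
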